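{- Let $R$ be a rank on a class of complete types. (1) If $R$ is a Lascar-splitting rank, then $R$ has Strong bounded multiplicity. (2) If $R$ has Bounded multiplicity and Extension, then $R$ is a Lascar-splitting rank.
   Context: $T$ is a complete first-order theory in a language $L$ with a monster model $\mathfrak C$ that is $\bar\kappa$-saturated and strongly $\bar\kappa$-homogeneous for a sufficiently large cardinal $\bar\kappa$ (e.g. strongly inaccessible). All parameter sets are small subsets of $\mathfrak C$ (cardinality $<\bar\kappa$), and cardinals quantified over in the definitions below are small. Complete types are finitary. A global type is a complete type over $\mathfrak C$. A class of complete types is a class $\mathfrak A$ of complete types closed under complete extensions and under conjugation by automorphisms of $\mathfrak C$. A rank on $\mathfrak A$ is a mapping $R:\mathfrak A\to\mathrm{Ord}\cup\{\infty\}$ with Heredity ($p\subseteq q$ implies $R(p)\ge R(q)$) and Isomorphism ($R(p)=R(p^f)$ for $f\in Aut(\mathfrak C)$); $p$ is ranked if $R(p)<\infty$. Lascar-splitting: $Autf(\mathfrak C/A)$ is the subgroup of $Aut(\mathfrak C/A)$ generated by the automorphisms fixing pointwise some model containing $A$; $a\stackrel{Ls}{\equiv}_A b$ means $a,b$ are in the same orbit under $Autf(\mathfrak C/A)$. A complete type $p(x)$ over $B\supseteq A$ (possibly $B=\mathfrak C$) Lascar-splits over $A$ if for some $\varphi(x,y)\in L$ there are tuples $a,b\in B$ with $a\stackrel{Ls}{\equiv}_A b$, $\varphi(x,a)\in p$, $\neg\varphi(x,b)\in p$. $R$ is a Lascar-splitting rank if for all $p\in S(A)$, $q\in S(B)$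 in $\mathfrak A$ with $p\subseteq q$, $p$ ranked, and every global extension of $q$ Lascar-splitting over $A$, one has $R(p)>R(q)$. $R$ has Bounded multiplicity if for each ranked $p\in\mathfrak A$, $p\in S(A)$, there is a cardinal $\kappa$ such that for any $B\supseteq A$, $p$ has at most $\kappa$ different extensions $q\in S(B)$ with $R(q)=R(p)$. $R$ has Strong bounded multiplicity if for each ranked $p\in\mathfrak A$ and each $k\ge 2$ there is a cardinal $\kappa$ such that any $k$-inconsistent collection of complete types extending $p$, all with the same rank as $p$, has cardinality at most $\kappa$ ($k$-inconsistent: the union of any $k$ distinct members is inconsistent). $R$ has Extension if for every ranked $p\in S(A)$ in $\mathfrak A$ and every $B\supseteq A$ there is an extension $q\in S(B)$ of $p$ with $R(p)=R(q)$. -}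

module Defs where

open import Level using (Level; _⊔_) renaming (suc to lsuc)
open import Data.Bool.Base using (Bool)
open import Data.Empty.Polymorphic using (⊥)
open import Data.Fin.Base using (Fin)
open import Data.List.Base as List using (List)
open import Data.List.Relation.Unary.All as ListAll using ()
open import Data.List.Relation.Unary.All.Properties as ListAllₚ using ()
open import Data.Nat.Base using (ℕ; suc; _+_; _≤_)
open import Data.Product using (Σ; Σ-syntax; ∃; ∃-syntax; _×_; _,_; proj₁; proj₂)
open import Data.Sum.Base using (_⊎_)
open import Data.Vec.Base as Vec using (Vec; []; _∷_; _++_; lookup)
open import Data.Vec.Properties using (lookup-map; map-++; map-∘; map-cong; map-id)
open import Data.Vec.Relation.Unary.All as VecAll using ()
open import Data.Vec.Relation.Unary.All.Properties as VecAllₚ using ()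
open import Function.Base using (_∘_)
open import Function.Bundles using (Injection; _↔_; Inverse; _⇔_; mk⇔; Equivalence)
open import Function.Construct.Composition using (_↔-∘_)
open import Function.Construct.Identity using (↔-id; ⇔-id)
open import Function.Construct.Symmetry using (↔-sym)
open import Induction.WellFounded using (WellFounded)
open import Relation.Binary.Bundles using (Setoid)
open import Relation.Binary.Construct.Add.Supremum.Equality as AddEq using ()
open import Relation.Binary.Construct.Add.Supremum.NonStrict as AddNonStrict using ()
open import Relation.Binary.Construct.Add.Supremum.Strict as AddStrict using ()
open import Relation.Binary.Construct.On as On using ()
open import Relation.Binary.Core using (Rel)
open import Relation.Binary.Morphism.Structures using (IsOrderIsomorphism)
open import Relation.Binary.PropositionalEquality
  using (_≡_; _≢_; refl; sym; trans; cong; cong₂; subst; setoid; _→-setoid_)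
open import Relation.Binary.Structures using (IsStrictTotalOrder)
open import Relation.Nullary.Construct.Add.Supremum using (_⁺; ⊤⁺)
open import Relation.Nullary.Negation using (¬_)
open import Relation.Unary using (Pred; _∈_; _⊆_; _≐_; _⊢_)
open import Relation.Unary.Polymorphic using (U)
open import Relation.Unary.Properties using (≐-refl; ≐-sym; ≐-trans)

private
  variable
    ℓ a b c : Level

-- Cardinality.  Sets are types in a fixed universe.  A subset is a
-- proof-relevant predicate, so cardinalities are compared through
-- setoids: the elements of a subset are identified when the underlying
-- elements are.

_<ᶜ_ : Setoid a b → Setoid c ℓ → Set (a ⊔ b ⊔ c ⊔ ℓ)
S <ᶜ S′ = Injection S S′ × ¬ Injection S′ S

subset : (S : Setoid a b) → Pred (Setoid.Carrier S) c → Setoid (a ⊔ c) b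
subset S P = On.setoid {B = Σ (Setoid.Carrier S) P} S proj₁

-- A cardinal is represented by a type of that size.
record StronglyInaccessible (κ̄ : Set ℓ) : Set (lsuc ℓ) where
  field
    uncountable : setoid ℕ <ᶜ setoid κ̄
    strongLimit : (X : Set ℓ) → setoid X <ᶜ setoid κ̄ →
                  (X →-setoid Bool) <ᶜ setoid κ̄
    regular     : (I : Set ℓ) (X : I → Set ℓ) → setoid I <ᶜ setoid κ̄ →
                  (∀ i → setoid (X i) <ᶜ setoid κ̄) →
                  setoid (Σ I X) <ᶜ setoid κ̄

-- Ordinals, as well-ordered sets compared up to order isomorphism

record Ordinal ℓ : Set (lsuc ℓ) where
  field
    Carrier            : Set ℓ
    _<_                : Rel Carrier ℓ
    isStrictTotalOrder : IsStrictTotalOrder _≡_ _<_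
    wellFounded        : WellFounded _<_

module _ (α β : Ordinal ℓ) where
  private
    module α = Ordinal α
    module β = Ordinal β

  Monotone : (α.Carrier → β.Carrier) → Set ℓ
  Monotone f = ∀ {x y} → x α.< y → f x β.< f y

  _≈ᵒ_ : Set ℓ
  _≈ᵒ_ = Σ[ f ∈ (α.Carrier → β.Carrier) ]
         IsOrderIsomorphism _≡_ _≡_ α._<_ β._<_ f

  -- α is isomorphic to an initial segment of β.
  _≤ᵒ_ : Set ℓ
  _≤ᵒ_ = Σ[ f ∈ (α.Carrier → β.Carrier) ]
         Monotone f × (∀ {x y} → y β.< f x → ∃[ x′ ] f x′ ≡ y)

  -- α is isomorphic to the initial segment of β below some element.
  _<ᵒ_ : Set ℓ
  _<ᵒ_ = Σ[ f ∈ (α.Carrier → β.Carrier) ] Σ[ z ∈ β.Carrier ]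
         Monotone f × (∀ y → y β.< z ⇔ (∃[ x ] f x ≡ y))

Ord∞ : ∀ ℓ → Set (lsuc ℓ)
Ord∞ ℓ = Ordinal ℓ ⁺

∞ : Ord∞ ℓ
∞ = ⊤⁺

infix 4 _≈∞_ _≤∞_ _<∞_

_≈∞_ _≤∞_ _<∞_ : Rel (Ord∞ ℓ) (lsuc ℓ)
_≈∞_ = AddEq._≈⁺_ _≈ᵒ_
_≤∞_ = AddNonStrict._≤⁺_ _≤ᵒ_
_<∞_ = AddStrict._<⁺_ _<ᵒ_

record Language ℓ : Set (lsuc ℓ) where
  field
    FunSym : ℕ → Set ℓ
    RelSym : ℕ → Set ℓ

module _ (L : Language ℓ) where
  open Language L

  data Term (n : ℕ) : Set ℓ where
    var : Fin n → Term n
    app : ∀ {k} → FunSym k → Vec (Term n) k → Term n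

  -- Formulas with n free variables; ∀′ binds variable 0.
  data Formula (n : ℕ) : Set ℓ where
    rel  : ∀ {k} → RelSym k → Vec (Term n) k → Formula n
    _≈′_ : Term n → Term n → Formula n
    ⊥′   : Formula n
    _⇒′_ : Formula n → Formula n → Formula n
    ∀′   : Formula (suc n) → Formula n

  ¬′_ : ∀ {n} → Formula n → Formula n
  ¬′ φ = φ ⇒′ ⊥′

  record Structure : Set (lsuc ℓ) where
    field
      Carrier  : Set ℓ
      nonempty : Carrier
      funᴹ     : ∀ {k} → FunSym k → Vec Carrier k → Carrier
      relᴹ     : ∀ {k} → RelSym k → Vec Carrier k → Set ℓ

  Theory : Set (lsuc ℓ)
  Theory = Pred (Formula 0) ℓ

module _ {L : Language ℓ} (M : Structure L) where
  open Structure M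

  mutual
    eval : ∀ {n} → Vec Carrier n → Term L n → Carrier
    eval v (var i)    = lookup v i
    eval v (app f ts) = funᴹ f (evals v ts)

    evals : ∀ {n k} → Vec Carrier n → Vec (Term L n) k → Vec Carrier k
    evals v []       = []
    evals v (t ∷ ts) = eval v t ∷ evals v ts

  _⊨_[_] : ∀ {n} → Formula L n → Vec Carrier n → Set ℓ
  _⊨_[_] (rel r ts) v = relᴹ r (evals v ts)
  _⊨_[_] (s ≈′ t)   v = eval v s ≡ eval v t
  _⊨_[_] ⊥′         v = ⊥
  _⊨_[_] (φ ⇒′ ψ)   v = _⊨_[_] φ v → _⊨_[_] ψ v
  _⊨_[_] (∀′ φ)     v = ∀ x → _⊨_[_] φ (x ∷ v)

module _ {L : Language ℓ} where

  _⊨ᵀ_ : Structure L → Theory L → Set ℓ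
  M ⊨ᵀ T = ∀ {σ} → σ ∈ T → M ⊨ σ [ [] ]

  _⊢ᵀ_ : Theory L → Formula L 0 → Set (lsuc ℓ)
  T ⊢ᵀ σ = (M : Structure L) → M ⊨ᵀ T → M ⊨ σ [ [] ]

  Complete : Theory L → Set (lsuc ℓ)
  Complete T = (∃[ M ] M ⊨ᵀ T) × (∀ σ → (T ⊢ᵀ σ) ⊎ (T ⊢ᵀ (¬′_ L σ)))

  -- An elementary embedding N → M.  Elementary submodels of M are taken
  -- to be the images of such embeddings.
  record _≼_ (N M : Structure L) : Set ℓ where
    private
      module N = Structure N
      module M = Structure M
    field
      embed      : N.Carrier → M.Carrier
      elementary : ∀ {n} (φ : Formula L n) v →
                   N ⊨ φ [ v ] ⇔ M ⊨ φ [ Vec.map embed v ]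

module _ {L : Language ℓ} (M : Structure L) where
  open Structure M

  record Aut : Set ℓ where
    field
      bijection : Carrier ↔ Carrier
    open Inverse bijection public using (to; from; strictlyInverseˡ; strictlyInverseʳ)
    field
      pres-fun  : ∀ {k} (f : Language.FunSym L k) v → to (funᴹ f v) ≡ funᴹ f (Vec.map to v)
      pres-rel  : ∀ {k} (r : Language.RelSym L k) v → relᴹ r v ⇔ relᴹ r (Vec.map to v)

    map-to-from : ∀ {n} (v : Vec Carrier n) → Vec.map to (Vec.map from v) ≡ v
    map-to-from v = trans (sym (map-∘ to from v))
                          (trans (map-cong strictlyInverseˡ v) (map-id v))

    map-from-to : ∀ {n} (v : Vec Carrier n) → Vec.map from (Vec.map to v) ≡ v
    map-from-to v = trans (sym (map-∘ from to v))
                          (trans (map-cong strictlyInverseʳ v) (map-id v))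

module _ {L : Language ℓ} {M : Structure L} where
  open Structure M
  open Aut

  idᴬ : Aut M
  idᴬ = record
    { bijection = ↔-id Carrier
    ; pres-fun  = λ f v → cong (funᴹ f) (sym (map-id v))
    ; pres-rel  = λ r v → subst (λ w → relᴹ r v ⇔ relᴹ r w) (sym (map-id v)) (⇔-id _)
    }

  -- (f ∘ᴬ g) x = f (g x)
  _∘ᴬ_ : Aut M → Aut M → Aut M
  f ∘ᴬ g = record
    { bijection = bijection f ↔-∘ bijection g
    ; pres-fun  = λ h v → trans (cong (to f) (pres-fun g h v))
                         (trans (pres-fun f h (Vec.map (to g) v))
                                (cong (funᴹ h) (sym (map-∘ (to f) (to g) v))))
    ; pres-rel  = λ r v → subst (λ w → relᴹ r v ⇔ relᴹ r w) (sym (map-∘ (to f) (to g) v))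
        (mk⇔ (λ p → Equivalence.to (pres-rel f r _) (Equivalence.to (pres-rel g r v) p))
             (λ p → Equivalence.from (pres-rel g r v) (Equivalence.from (pres-rel f r _) p)))
    }

  _⁻¹ᴬ : Aut M → Aut M
  f ⁻¹ᴬ = record
    { bijection = ↔-sym (bijection f)
    ; pres-fun  = λ h v → trans
        (cong (from f) (trans (cong (funᴹ h) (sym (map-to-from f v)))
                              (sym (pres-fun f h (Vec.map (from f) v)))))
        (strictlyInverseʳ f _)
    ; pres-rel  = λ r v →
        let e = pres-rel f r (Vec.map (from f) v)
            q = map-to-from f v
        in mk⇔ (λ p → Equivalence.from e (subst (relᴹ r) (sym q) p))
               (λ p → subst (relᴹ r) q (Equivalence.to e p))
    }

  mutual
    eval-aut : (f : Aut M) → ∀ {n} (v : Vec Carrier n) t →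
               eval M (Vec.map (to f) v) t ≡ to f (eval M v t)
    eval-aut f v (var i)    = lookup-map i (to f) v
    eval-aut f v (app h ts) =
      trans (cong (funᴹ h) (evals-aut f v ts)) (sym (pres-fun f h _))

    evals-aut : (f : Aut M) → ∀ {n k} (v : Vec Carrier n) (ts : Vec (Term L n) k) →
                evals M (Vec.map (to f) v) ts ≡ Vec.map (to f) (evals M v ts)
    evals-aut f v []       = refl
    evals-aut f v (t ∷ ts) = cong₂ _∷_ (eval-aut f v t) (evals-aut f v ts)

  ⊨-aut : (f : Aut M) → ∀ {n} (φ : Formula L n) v →
          M ⊨ φ [ v ] ⇔ M ⊨ φ [ Vec.map (to f) v ]
  ⊨-aut f (rel r ts) v =
    subst (λ w → relᴹ r (evals M v ts) ⇔ relᴹ r w) (sym (evals-aut f v ts)) (pres-rel f r _)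
  ⊨-aut f (s ≈′ t) v = mk⇔
    (λ p → trans (eval-aut f v s) (trans (cong (to f) p) (sym (eval-aut f v t))))
    (λ p → trans (sym (strictlyInverseʳ f _))
          (trans (cong (from f) (trans (sym (eval-aut f v s)) (trans p (eval-aut f v t))))
                 (strictlyInverseʳ f _)))
  ⊨-aut f ⊥′ v = ⇔-id _
  ⊨-aut f (φ ⇒′ ψ) v = mk⇔
    (λ h p → Equivalence.to (⊨-aut f ψ v) (h (Equivalence.from (⊨-aut f φ v) p)))
    (λ h p → Equivalence.from (⊨-aut f ψ v) (h (Equivalence.to (⊨-aut f φ v) p)))
  ⊨-aut f (∀′ φ) v = mk⇔
    (λ h y → subst (λ z → M ⊨ φ [ z ∷ Vec.map (to f) v ]) (strictlyInverseˡ f y)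
                   (Equivalence.to (⊨-aut f φ (from f y ∷ v)) (h (from f y))))
    (λ h x → Equivalence.from (⊨-aut f φ (x ∷ v)) (h (to f x)))

-- φ(x,a), with φ ∈ L, x an n-tuple of variables (coming first) and a a
-- tuple of parameters from M.
record ParamFormula {L : Language ℓ} (M : Structure L) (n : ℕ) : Set ℓ where
  constructor _⟨_⟩
  field
    {arity} : ℕ
    formula : Formula L (n + arity)
    params  : Vec (Structure.Carrier M) arity

_∈ᵗ_ : {X : Set ℓ} {m : ℕ} → Vec X m → Pred X ℓ → Set ℓ
v ∈ᵗ A = VecAll.All (_∈ A) v

module _ {L : Language ℓ} {M : Structure L} where
  open Structure M using (Carrier)
  open ParamFormula
  open Aut

  _Over_ : ∀ {n} → ParamFormula M n → Pred Carrier ℓ → Set ℓ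
  φ Over A = params φ ∈ᵗ A

  ¬ᵖ_ : ∀ {n} → ParamFormula M n → ParamFormula M n
  ¬ᵖ (φ ⟨ a ⟩) = (¬′_ L φ) ⟨ a ⟩

  _⊩_ : ∀ {n} → Vec Carrier n → ParamFormula M n → Set ℓ
  b ⊩ (φ ⟨ a ⟩) = M ⊨ φ [ b ++ a ]

  -- Finite satisfiability in M, which by compactness is consistency with
  -- the theory of M with names for its elements.
  Consistent : ∀ {n} → Pred (ParamFormula M n) ℓ → Set ℓ
  Consistent {n} Γ = (Δ : List (ParamFormula M n)) → ListAll.All (_∈ Γ) Δ →
                     ∃[ b ] ListAll.All (b ⊩_) Δ

  -- f (φ(x,a)) = φ(x,f(a))
  mapᵖ : ∀ {n} → (Carrier → Carrier) → ParamFormula M n → ParamFormula M n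
  mapᵖ f (φ ⟨ a ⟩) = φ ⟨ Vec.map f a ⟩

-- S M A n is the set of complete types over A in n variables.
record S {L : Language ℓ} (M : Structure L) (A : Pred (Structure.Carrier M) ℓ)
         (n : ℕ) : Set (lsuc ℓ) where
  field
    formulas   : Pred (ParamFormula M n) ℓ
    over       : ∀ {φ} → φ ∈ formulas → φ Over A
    consistent : Consistent formulas
    complete   : ∀ φ → φ Over A → (φ ∈ formulas) ⊎ ((¬ᵖ φ) ∈ formulas)

module _ {L : Language ℓ} {M : Structure L} where
  open Structure M using (Carrier)
  open Aut
  open S

  private
    variable
      n   : ℕ
      A B : Pred Carrier ℓ

  infix 4 _⊑_ _≋_

  _⊑_ : S M A n → S M B n → Set ℓ
  p ⊑ q = formulas p ⊆ formulas q

  _≋_ : S M A n → S M B n → Set ℓ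
  p ≋ q = formulas p ≐ formulas q

  GlobalType : ℕ → Set (lsuc ℓ)
  GlobalType n = S M U n

  -- f(A), as the preimage of A under the inverse of f.
  image : Aut M → Pred Carrier ℓ → Pred Carrier ℓ
  image f A = from f ⊢ A

  ⊩-aut : (f : Aut M) (b : Vec Carrier n) (φ : ParamFormula M n) →
          b ⊩ mapᵖ (from f) φ → Vec.map (to f) b ⊩ φ
  ⊩-aut f b (φ ⟨ a ⟩) h =
    subst (λ w → M ⊨ φ [ w ])
      (trans (map-++ (to f) b (Vec.map (from f) a))
             (cong (Vec.map (to f) b ++_) (map-to-from f a)))
      (Equivalence.to (⊨-aut f φ (b ++ Vec.map (from f) a)) h)

  -- p^f = { φ(x,f(a)) : φ(x,a) ∈ p }
  _^_ : S M A n → (f : Aut M) → S M (image f A) n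
  p ^ f = record
    { formulas   = mapᵖ (from f) ⊢ formulas p
    ; over       = λ h → VecAllₚ.map⁻ (over p h)
    ; consistent = λ Δ h →
        let b , s = consistent p (List.map (mapᵖ (from f)) Δ) (ListAllₚ.map⁺ h)
        in Vec.map (to f) b , ListAll.map (λ {φ} → ⊩-aut f b φ) (ListAllₚ.map⁻ s)
    ; complete   = λ φ h → complete p (mapᵖ (from f) φ) (VecAllₚ.map⁺ h)
    }

-- Complete n-types over arbitrary subsets, with equality as sets of
-- formulas; such an equality forces the domains to agree too.
typeSetoid : {L : Language ℓ} (M : Structure L) → ℕ → Setoid (lsuc ℓ) ℓ
typeSetoid M n = record
  { Carrier       = Σ[ A ∈ Pred (Structure.Carrier M) _ ] S M A n
  ; _≈_           = λ (_ , p) (_ , q) → p ≋ q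
  ; isEquivalence = record { refl = ≐-refl ; sym = ≐-sym ; trans = ≐-trans }
  }

record MonsterModel {L : Language ℓ} (T : Theory L) : Set (lsuc ℓ) where
  open Language L
  field
    κ̄            : Set ℓ
    inaccessible : StronglyInaccessible κ̄
    smallFun     : setoid (Σ ℕ FunSym) <ᶜ setoid κ̄
    smallRel     : setoid (Σ ℕ RelSym) <ᶜ setoid κ̄
    ℭ            : Structure L
    models       : ℭ ⊨ᵀ T

  open Structure ℭ public using () renaming (Carrier to ∣ℭ∣)

  SmallCardinal : Set ℓ → Set ℓ
  SmallCardinal κ = setoid κ <ᶜ setoid κ̄

  Small : Pred ∣ℭ∣ ℓ → Set ℓ
  Small A = subset (setoid ∣ℭ∣) A <ᶜ setoid κ̄

  SameType : {I : Set ℓ} → (I → ∣ℭ∣) → (I → ∣ℭ∣) → Set ℓ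
  SameType {I} a b = ∀ {n} (φ : Formula L n) (i : Vec I n) →
                     ℭ ⊨ φ [ Vec.map a i ] ⇔ ℭ ⊨ φ [ Vec.map b i ]

  field
    saturated   : ∀ {n} {A : Pred ∣ℭ∣ ℓ} → Small A → (p : S ℭ A n) →
                  ∃[ b ] (∀ {φ} → φ ∈ S.formulas p → b ⊩ φ)
    homogeneous : {I : Set ℓ} → SmallCardinal I → (a b : I → ∣ℭ∣) → SameType a b →
                  Σ[ f ∈ Aut ℭ ] (∀ i → Aut.to f (a i) ≡ b i)

module _ {L : Language ℓ} {T : Theory L} (𝕄 : MonsterModel T) where
  open MonsterModel 𝕄
  open Aut
  open S

  FixesPointwise : Pred ∣ℭ∣ ℓ → Aut ℭ → Set ℓ
  FixesPointwise A f = ∀ {x} → x ∈ A → to f x ≡ x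

  record SmallModelContaining (A : Pred ∣ℭ∣ ℓ) : Set (lsuc ℓ) where
    field
      N        : Structure L
      N≼ℭ      : N ≼ ℭ
      small    : SmallCardinal (Structure.Carrier N)
      contains : ∀ {x} → x ∈ A → ∃[ y ] _≼_.embed N≼ℭ y ≡ x

    universe : Pred ∣ℭ∣ ℓ
    universe x = ∃[ y ] _≼_.embed N≼ℭ y ≡ x

  -- Autf(ℭ/A).  Automorphisms are equal when they agree pointwise.
  data Autf (A : Pred ∣ℭ∣ ℓ) : Aut ℭ → Set (lsuc ℓ) where
    fixing  : ∀ {f} (N : SmallModelContaining A) →
              FixesPointwise (SmallModelContaining.universe N) f → Autf A f
    unit    : Autf A idᴬ
    compose : ∀ {f g} → Autf A f → Autf A g → Autf A (f ∘ᴬ g)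
    inverse : ∀ {f} → Autf A f → Autf A (f ⁻¹ᴬ)
    respect : ∀ {f g} → (∀ x → to f x ≡ to g x) → Autf A f → Autf A g

  LascarEquiv : ∀ {m} → Pred ∣ℭ∣ ℓ → Vec ∣ℭ∣ m → Vec ∣ℭ∣ m → Set (lsuc ℓ)
  LascarEquiv A a b = ∃[ f ] Autf A f × Vec.map (to f) a ≡ b

  LascarSplits : ∀ {n} {B : Pred ∣ℭ∣ ℓ} → S ℭ B n → Pred ∣ℭ∣ ℓ → Set (lsuc ℓ)
  LascarSplits {n} {B} p A =
    ∃[ m ] Σ[ φ ∈ Formula L (n + m) ] Σ[ a ∈ Vec ∣ℭ∣ m ] Σ[ b ∈ Vec ∣ℭ∣ m ]
      a ∈ᵗ B × b ∈ᵗ B × LascarEquiv A a b ×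
      (φ ⟨ a ⟩) ∈ formulas p × (¬ᵖ (φ ⟨ b ⟩)) ∈ formulas p

  -- Every parameter set is small; only global types are exempt, and
  -- they are not members of a class.
  record TypeClass : Set (lsuc (lsuc ℓ)) where
    field
      Member      : ∀ {n A} → S ℭ A n → Set (lsuc ℓ)
      small       : ∀ {n A} {p : S ℭ A n} → Member p → Small A
      extension   : ∀ {n A B} {p : S ℭ A n} {q : S ℭ B n} →
                    Member p → Small B → p ⊑ q → Member q
      conjugation : ∀ {n A} {p : S ℭ A n} → Member p → (f : Aut ℭ) → Member (p ^ f)

  record Rank (𝔄 : TypeClass) : Set (lsuc ℓ) where
    open TypeClass 𝔄
    field
      R           : ∀ {n A} {p : S ℭ A n} → Member p → Ord∞ ℓ
      heredity    : ∀ {n A B} {p : S ℭ A n} {q : S ℭ B n}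
                    (p∈ : Member p) (q∈ : Member q) → p ⊑ q → R q∈ ≤∞ R p∈
      isomorphism : ∀ {n A} {p : S ℭ A n} (p∈ : Member p) (f : Aut ℭ) →
                    R p∈ ≈∞ R (conjugation p∈ f)

    Ranked : ∀ {n A} {p : S ℭ A n} → Member p → Set (lsuc ℓ)
    Ranked p∈ = R p∈ <∞ ∞

  module _ {𝔄 : TypeClass} (𝓡 : Rank 𝔄) where
    open TypeClass 𝔄
    open Rank 𝓡

    LascarSplittingRank : Set (lsuc ℓ)
    LascarSplittingRank =
      ∀ {n A B} {p : S ℭ A n} {q : S ℭ B n} (p∈ : Member p) (q∈ : Member q) →
      p ⊑ q → Ranked p∈ →
      ((𝔮 : GlobalType n) → q ⊑ 𝔮 → LascarSplits 𝔮 A) →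
      R q∈ <∞ R p∈

    -- q ⊇ p and R(q) = R(p).
    SameRankExtension : ∀ {n A B} {p : S ℭ A n} → Member p → S ℭ B n → Set (lsuc ℓ)
    SameRankExtension {p = p} p∈ q =
      p ⊑ q × (Σ[ q∈ ∈ Member q ] R q∈ ≈∞ R p∈)

    BoundedMultiplicity : Set (lsuc ℓ)
    BoundedMultiplicity =
      ∀ {n A} {p : S ℭ A n} (p∈ : Member p) → Ranked p∈ →
      Σ[ κ ∈ Set ℓ ] SmallCardinal κ ×
      ((B : Pred ∣ℭ∣ ℓ) → Small B → A ⊆ B →
       Injection (subset (On.setoid {B = S ℭ B n} (typeSetoid ℭ n) (B ,_))
                         (SameRankExtension p∈))
                 (setoid κ))

    Collection : ℕ → Set (lsuc (lsuc ℓ))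
    Collection n = Pred (Setoid.Carrier (typeSetoid ℭ n)) (lsuc ℓ)

    _-Inconsistent_ : ∀ {n} → ℕ → Collection n → Set (lsuc ℓ)
    _-Inconsistent_ {n} k 𝒬 =
      (q : Fin k → Setoid.Carrier (typeSetoid ℭ n)) → (∀ i → q i ∈ 𝒬) →
      (∀ {i j} → i ≢ j → ¬ (proj₂ (q i) ≋ proj₂ (q j))) →
      ¬ Consistent {M = ℭ} (λ φ → ∃[ i ] φ ∈ formulas (proj₂ (q i)))

    StrongBoundedMultiplicity : Set (lsuc (lsuc ℓ))
    StrongBoundedMultiplicity =
      ∀ {n A} {p : S ℭ A n} (p∈ : Member p) → Ranked p∈ → (k : ℕ) → 2 ≤ k →
      Σ[ κ ∈ Set ℓ ] SmallCardinal κ ×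
      ((𝒬 : Collection n) →
       (∀ {B q} → (B , q) ∈ 𝒬 → SameRankExtension p∈ q) →
       k -Inconsistent 𝒬 →
       Injection (subset (typeSetoid ℭ n) 𝒬) (setoid κ))

    Extension : Set (lsuc ℓ)
    Extension =
      ∀ {n A} {p : S ℭ A n} (p∈ : Member p) → Ranked p∈ →
      (B : Pred ∣ℭ∣ ℓ) → Small B → A ⊆ B →
      Σ[ q ∈ S ℭ B n ] SameRankExtension p∈ q

{-# OPTIONS --safe #-}

-- (1) If R is a Lascar-splitting rank, then every type q ⊇ p with
-- R(q) = R(p) has a global extension that does not Lascar-split over A.
-- Such an extension is invariant over any small model N ⊇ A, so there is
-- only a small number of them, and in a k-inconsistent collection fewer
-- than k types can share the same one.
--
-- (2) For a formula φ(x,y), let c ~ d if φ(x,c) and φ(x,d) get the same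
-- truth value in every extension of p with the rank of p.  Extension makes ~
-- transitive, it is invariant under Aut(ℭ/A), and Bounded multiplicity
-- bounds the number of its classes.  Hence it contains Lascar equivalence
-- over A: if a and b have the same type over a model N ⊇ A, let M be a small
-- set containing N and representatives of all classes that meet this type.
-- A realization a* of the type whose type over M does not split over N is
-- equivalent to one of the representatives, hence to all of them, hence to
-- a and b.  So an extension q of p with R(q) = R(p) is finitely consistent
-- with not Lascar-splitting over A, and it has a global extension that does
-- not Lascar-split over A.
module Submission where

open import Defs
open import Axiom.ExcludedMiddle using (ExcludedMiddle)
open import Axiom.Extensionality.Propositional using (Extensionality)
open import Axiom.UniquenessOfIdentityProofs.WithK using (uip)
open import Data.Bool.Base using (Bool; true; false)
open import Data.Empty using (⊥-elim)
import Data.Empty.Polymorphic as Poly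
open import Data.Fin.Base as Fin using (Fin; zero; suc; toℕ; _↑ˡ_; _↑ʳ_; splitAt)
open import Data.Fin.Properties using (toℕ-injective)
open import Data.List.Base as List using (List; []; _∷_)
import Data.List.Membership.Propositional as List∈
open import Data.List.Properties using (∷-injective; ++-assoc)
open import Data.List.Relation.Unary.All as All using (All; []; _∷_)
open import Data.List.Relation.Unary.All.Properties using (++⁺; ++⁻ˡ; ++⁻ʳ)
open import Data.List.Relation.Unary.Any using (here; there)
open import Data.Nat.Base using (ℕ; zero; suc; _+_)
open import Data.Product using (Σ; Σ-syntax; ∃-syntax; _×_; _,_; proj₁; proj₂)
open import Data.Sum.Base as Sum using (_⊎_; inj₁; inj₂; [_,_]′)
open import Data.Unit.Polymorphic.Base using (tt)
open import Data.Vec.Base as Vec using (Vec; []; _∷_; lookup; _++_)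
open import Data.Vec.Properties using (toList∘fromList; lookup-map; map-++; map-∘; map-cong; map-id; lookup-++ˡ; lookup-++ʳ; lookup-splitAt; tabulate∘lookup; tabulate-cong)
open import Data.Vec.Relation.Unary.All as VecAll using ([]; _∷_)
import Data.Vec.Relation.Unary.All.Properties as VecAllₚ
open import Function.Base using (_∘_; id; const)
open import Function.Bundles using (Injection; _⇔_; mk⇔; Equivalence)
open import Function.Construct.Composition using () renaming (injection to _↣-∘_)
open import Induction.WellFounded using (Acc; acc)
open import Level using (Level; Lift; lift; lower)
open import Relation.Binary.Bundles using (Setoid)
open import Relation.Binary.Construct.Add.Supremum.Equality using () renaming ([_] to [_]≈; ⊤⁺≈⊤⁺ to ⊤≈⊤)
open import Relation.Binary.Construct.Add.Supremum.NonStrict using (_≤⊤⁺; ≤⁺-trans) renaming ([_] to [_]≤)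
open import Relation.Binary.Construct.Add.Supremum.Strict using ([_]<⊤⁺) renaming ([_] to [_]<)
open import Relation.Binary.Definitions using (tri<; tri≈; tri>)
open import Relation.Binary.Morphism.Structures using (IsOrderIsomorphism)
open import Relation.Binary.PropositionalEquality using (_≡_; _≢_; refl; sym; trans; cong; cong₂; subst; setoid; subst₂; cong-app)
open import Relation.Binary.Structures using (IsStrictTotalOrder)
open import Relation.Nullary.Construct.Add.Supremum using (⊤⁺; [_])
open import Relation.Nullary.Decidable using (Dec; yes; no; does)
open import Relation.Nullary.Negation using (¬_; contradiction)
open import Relation.Unary using (Pred; _∈_; _⊆_; _∪_)

private
  variable
    ℓ : Level

-- Classical logic: choice, diagonalization and maximality.

module Classical (em : ∀ {a} → ExcludedMiddle a) (ext : ∀ {a b} → Extensionality a b) where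

  private
    variable
      a b c : Level
      X Y : Set a

  lem : (P : Set a) → Dec P
  lem P = em

  -- The truth value of P; it moves propositions to the lowest universe
  -- and makes them proof-irrelevant.
  ⌊_⌋ : Set a → Bool
  ⌊ P ⌋ = does (lem P)

  ⌊⌋-intro : {P : Set a} → P → ⌊ P ⌋ ≡ true
  ⌊⌋-intro {P = P} p with lem P
  ... | yes _ = refl
  ... | no ¬p = contradiction p ¬p

  ⌊⌋-elim : {P : Set a} → ⌊ P ⌋ ≡ true → P
  ⌊⌋-elim {P = P} e with lem P
  ... | yes p = p
  ⌊⌋-elim () | no _

  ⌊⌋-cong : {P : Set a} {Q : Set b} → (P → Q) → (Q → P) → ⌊ P ⌋ ≡ ⌊ Q ⌋
  ⌊⌋-cong {P = P} {Q = Q} f g with lem P | lem Q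
  ... | yes _ | yes _ = refl
  ... | no _  | no _  = refl
  ... | yes p | no ¬q = contradiction (f p) ¬q
  ... | no ¬p | yes q = contradiction (g q) ¬p

  ⌊⌋-≡⁻ : {P : Set a} {Q : Set b} → ⌊ P ⌋ ≡ ⌊ Q ⌋ → P → Q
  ⌊⌋-≡⁻ e p = ⌊⌋-elim (trans (sym e) (⌊⌋-intro p))

  ¬¬-elim : {P : Set a} → ¬ ¬ P → P
  ¬¬-elim {P = P} ¬¬p with lem P
  ... | yes p = p
  ... | no ¬p = contradiction ¬p ¬¬p

  ¬∀⇒∃¬ : {P : X → Set b} → ¬ (∀ x → P x) → ∃[ x ] ¬ P x
  ¬∀⇒∃¬ h = ¬¬-elim λ ¬∃ → h λ x → ¬¬-elim λ ¬p → ¬∃ (x , ¬p)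

  Bool-cong : ∀ {x y : Bool} → (x ≡ true → y ≡ true) → (y ≡ true → x ≡ true) → x ≡ y
  Bool-cong {true}  f g = sym (f refl)
  Bool-cong {false} {true}  f g = g refl
  Bool-cong {false} {false} f g = refl

  -- The result comes from excluded middle and not from the given witness, so it depends on `χ`
  -- alone: a choice operator.
  choose : (χ : X → Bool) → ∃[ x ] χ x ≡ true → ∃[ x ] χ x ≡ true
  choose χ w with lem (∃[ x ] χ x ≡ true)
  ... | yes c = c
  ... | no ¬w = contradiction w ¬w

  choose-irrelevant : (χ χ′ : X → Bool) (w : ∃[ x ] χ x ≡ true) (w′ : ∃[ x ] χ′ x ≡ true) →
                      χ ≡ χ′ → proj₁ (choose χ w) ≡ proj₁ (choose χ′ w′)
  choose-irrelevant χ .χ w w′ refl with lem (∃[ x ] χ x ≡ true)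
  ... | yes _ = refl
  ... | no ¬w = contradiction w ¬w

  -- A labelling that separates inequivalent elements need not respect
  -- equivalence; picking one label per class repairs this.
  separating⇒Injection : (S : Setoid a b) (f : Setoid.Carrier S → X) →
    (∀ x y → f x ≡ f y → Setoid._≈_ S x y) → Injection S (setoid X)
  separating⇒Injection {X = X} S f f-sep = record
    { to        = λ x → proj₁ (choose (χ x) (w x))
    ; cong      = λ {x} {y} x≈y → choose-irrelevant (χ x) (χ y) (w x) (w y)
        (ext λ k → ⌊⌋-cong
          (λ (z , z≈x , e) → z , 𝑆.trans z≈x x≈y , e)
          (λ (z , z≈y , e) → z , 𝑆.trans z≈y (𝑆.sym x≈y) , e))
    ; injective = λ {x} {y} e →
        let z  , z≈x  , p  = ⌊⌋-elim (proj₂ (choose (χ x) (w x)))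
            z′ , z′≈y , p′ = ⌊⌋-elim (proj₂ (choose (χ y) (w y)))
        in 𝑆.trans (𝑆.sym z≈x) (𝑆.trans (f-sep z z′ (trans p (trans e (sym p′)))) z′≈y)
    }
    where
    module 𝑆 = Setoid S

    χ : 𝑆.Carrier → X → Bool
    χ x k = ⌊ Σ[ z ∈ 𝑆.Carrier ] (z 𝑆.≈ x × f z ≡ k) ⌋

    w : ∀ x → ∃[ k ] χ x k ≡ true
    w x = f x , ⌊⌋-intro (x , 𝑆.refl , refl)

  -- Diagonal argument: `d` collects the values `f s` lying outside `s`, and membership of `f d` in
  -- `d` is contradictory.
  cantor : (f : (X → Bool) → X) → ¬ (∀ s t → f s ≡ f t → s ≡ t)
  cantor {X = X} f inj = d⊬ d⊢
    where
    d : X → Bool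
    d x = ⌊ (Σ[ s ∈ (X → Bool) ] f s ≡ x × ¬ s x ≡ true) ⌋

    d⊬ : ¬ d (f d) ≡ true
    d⊬ h = let s , e , ¬p = ⌊⌋-elim h in ¬p (subst (λ t → t (f d) ≡ true) (sym (inj s d e)) h)

    d⊢ : d (f d) ≡ true
    d⊢ = ⌊⌋-intro (d , refl , d⊬)

  -- Greedy selection: pairwise unrelated elements either cover everything or admit one more that is
  -- unrelated to all of them.
  manyDistinct⊎finiteCover : (_~_ : X → X → Set b) → (∀ {x y} → x ~ y → y ~ x) → (k : ℕ) →
    (Σ[ q ∈ (Fin k → X) ] ∀ {i j} → i ≢ j → ¬ q i ~ q j) ⊎
    (∃[ j ] Σ[ g ∈ (Fin j → X) ] ∀ x → ∃[ i ] x ~ g i)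
  manyDistinct⊎finiteCover _~_ ~-sym zero = inj₁ ((λ ()) , λ { {()} })
  manyDistinct⊎finiteCover {X = X} _~_ ~-sym (suc k) with manyDistinct⊎finiteCover _~_ ~-sym k
  ... | inj₂ cover = inj₂ cover
  ... | inj₁ (q , distinct) with lem (∃[ x ] ∀ i → ¬ x ~ q i)
  ...   | no ¬new = inj₂ (k , q , λ x → ¬¬-elim λ ¬∃ → ¬new (x , λ i e → ¬∃ (i , e)))
  ...   | yes (x , new) = inj₁ (q′ , distinct′)
    where
    q′ : Fin (suc k) → X
    q′ zero    = x
    q′ (suc i) = q i

    distinct′ : ∀ {i j} → i ≢ j → ¬ q′ i ~ q′ j
    distinct′ {zero}  {zero}  i≢j e = i≢j refl
    distinct′ {zero}  {suc j} i≢j e = new j e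
    distinct′ {suc i} {zero}  i≢j e = new i (~-sym e)
    distinct′ {suc i} {suc j} i≢j e = distinct (i≢j ∘ cong suc) e

  -- The Teichmüller–Tukey lemma, for a family of finite character given
  -- by its finite members.
  module Tukey {X : Set a} (C : List X → Set b) (C-[] : C [])
    (C-anti : ∀ {l l′} → (∀ {y} → y List∈.∈ l → y List∈.∈ l′) → C l′ → C l) where

    infix 4 _∈ᵇ_ _⊆ᵇ_

    _∈ᵇ_ : X → (X → Bool) → Set
    x ∈ᵇ S = S x ≡ true

    _⊆ᵇ_ : (X → Bool) → (X → Bool) → Set a
    S ⊆ᵇ S′ = ∀ {x} → x ∈ᵇ S → x ∈ᵇ S′

    Good : (X → Bool) → Set _
    Good S = ∀ l → All (_∈ᵇ S) l → C l

    insert : X → (X → Bool) → (X → Bool)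
    insert x S y = ⌊ y ∈ᵇ S ⊎ y ≡ x ⌋

    Extendable : (X → Bool) → Set _
    Extendable S = ∃[ x ] ¬ x ∈ᵇ S × Good (insert x S)

    next : (X → Bool) → (X → Bool)
    next S with lem (Extendable S)
    ... | yes (x , _) = insert x S
    ... | no _        = S

    ⊆-next : ∀ S → S ⊆ᵇ next S
    ⊆-next S x∈S with lem (Extendable S)
    ... | yes _ = ⌊⌋-intro (inj₁ x∈S)
    ... | no _  = x∈S

    ⋃ : ((X → Bool) → Bool) → (X → Bool)
    ⋃ Q x = ⌊ (Σ[ S ∈ (X → Bool) ] Q S ≡ true × x ∈ᵇ S) ⌋

    -- Replaces transfinite iteration of `next`. The empty set arises from `lim` applied to the
    -- empty family.
    data Tower : (X → Bool) → Set a where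
      step : ∀ {S} → Tower S → Tower (next S)
      lim  : ∀ Q → (∀ S → Q S ≡ true → Tower S) → Tower (⋃ Q)

    -- Having `next S` on the left lets the induction pass successors: if `S` and `S″` include each
    -- other, extensionality identifies them and so their successors.
    linear : ∀ {S S′} → Tower S → Tower S′ → (next S ⊆ᵇ S′) ⊎ (S′ ⊆ᵇ S)
    linear {S} t (step {S″} t′) with linear t t′
    ... | inj₁ S⁺⊆S″ = inj₁ (λ x∈ → ⊆-next S″ (S⁺⊆S″ x∈))
    ... | inj₂ S″⊆S with linear t′ t
    ...   | inj₁ S″⁺⊆S = inj₂ S″⁺⊆S
    ...   | inj₂ S⊆S″ = inj₁ (λ {x} → subst (λ R → x ∈ᵇ next R) (ext λ y → Bool-cong S⊆S″ S″⊆S))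
    linear {S} t (lim Q h) with lem (Σ[ R ∈ (X → Bool) ] Q R ≡ true × (next S ⊆ᵇ R))
    ... | yes (R , R∈Q , S⁺⊆R) = inj₁ (λ x∈ → ⌊⌋-intro (R , R∈Q , S⁺⊆R x∈))
    ... | no ¬above = inj₂ (λ {x} x∈ → below x (⌊⌋-elim x∈))
      where
      below : ∀ x → (Σ[ R ∈ (X → Bool) ] Q R ≡ true × x ∈ᵇ R) → x ∈ᵇ S
      below x (R , R∈Q , x∈R) with linear t (h R R∈Q)
      ... | inj₁ S⁺⊆R = ⊥-elim (¬above (R , R∈Q , S⁺⊆R))
      ... | inj₂ R⊆S  = R⊆S x∈R

    chain : ∀ {S S′} → Tower S → Tower S′ → (S ⊆ᵇ S′) ⊎ (S′ ⊆ᵇ S)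
    chain {S} t t′ with linear t t′
    ... | inj₁ S⁺⊆S′ = inj₁ (λ x∈ → S⁺⊆S′ (⊆-next S x∈))
    ... | inj₂ S′⊆S  = inj₂ S′⊆S

    -- Tower members form a chain, so among the finitely many members that contain the entries of
    -- `l` one is largest. The empty list is set apart because `Q` may have no members.
    capture : ∀ Q → (∀ S → Q S ≡ true → Tower S) → ∀ l → All (_∈ᵇ ⋃ Q) l →
              l ≡ [] ⊎ (Σ[ S ∈ (X → Bool) ] Q S ≡ true × All (_∈ᵇ S) l)
    capture Q h []      []        = inj₁ refl
    capture Q h (x ∷ l) (px ∷ pl) with ⌊⌋-elim px | capture Q h l pl
    ... | S , S∈Q , x∈S | inj₁ refl = inj₂ (S , S∈Q , x∈S ∷ [])
    ... | S , S∈Q , x∈S | inj₂ (S′ , S′∈Q , l⊆S′) with chain (h S S∈Q) (h S′ S′∈Q)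
    ...   | inj₁ S⊆S′ = inj₂ (S′ , S′∈Q , S⊆S′ x∈S ∷ l⊆S′)
    ...   | inj₂ S′⊆S = inj₂ (S , S∈Q , x∈S ∷ All.map S′⊆S l⊆S′)

    good : ∀ {S} → Tower S → Good S
    good (step {S} t) with lem (Extendable S)
    ... | yes (_ , _ , g) = g
    ... | no _            = good t
    good (lim Q h) l l⊆ with capture Q h l l⊆
    ... | inj₁ refl             = C-[]
    ... | inj₂ (S , S∈Q , l⊆S) = good (h S S∈Q) l l⊆S

    -- The union of all tower members is itself a tower member by `lim`, hence the largest one.
    top : X → Bool
    top = ⋃ (λ S → ⌊ Tower S ⌋)

    Tower-top : Tower top
    Tower-top = lim _ (λ _ → ⌊⌋-elim)

    top-good : Good top
    top-good = good Tower-top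

    -- `next top` is a tower member and so included in `top`, yet an extension would contain an
    -- element outside `top`.
    ¬Extendable-top : ¬ Extendable top
    ¬Extendable-top e with lem (Extendable top) in eq
    ... | no ¬e = ¬e e
    ... | yes (x , x∉ , _) = x∉ (⌊⌋-intro (next top , ⌊⌋-intro (step Tower-top) , x∈next))
      where
      x∈next : x ∈ᵇ next top
      x∈next rewrite eq = ⌊⌋-intro (inj₂ refl)

    remove : ∀ x S l → All (_∈ᵇ insert x S) l →
             ∃[ l′ ] All (_∈ᵇ S) l′ × (∀ {y} → y List∈.∈ l → y List∈.∈ x ∷ l′)
    remove x S []      []        = [] , [] , λ ()
    remove x S (y ∷ l) (py ∷ pl) with remove x S l pl | ⌊⌋-elim py
    ... | l′ , l′⊆S , l⊆ | inj₂ refl = l′ , l′⊆S , λ { (here e) → here e ; (there z∈) → l⊆ z∈ }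
    ... | l′ , l′⊆S , l⊆ | inj₁ y∈S  = y ∷ l′ , y∈S ∷ l′⊆S , λ
      { (here e) → there (here e)
      ; (there z∈) → weaken (l⊆ z∈)
      }
      where
      weaken : ∀ {z} → z List∈.∈ x ∷ l′ → z List∈.∈ x ∷ y ∷ l′
      weaken (here e)   = here e
      weaken (there z∈) = there (there z∈)

    -- `insert x top` is not good. Taking `x` out of a list that shows this leaves a list in `top`,
    -- and `C-anti` transfers the failure.
    maximal : ∀ x → ¬ x ∈ᵇ top → ∃[ l ] All (_∈ᵇ top) l × ¬ C (x ∷ l)
    maximal x x∉ = ¬¬-elim λ ¬∃ → ¬Extendable-top (x , x∉ , λ l l⊆ →
      let l′ , l′⊆ , l⊆xl′ = remove x top l l⊆
      in ¬¬-elim λ ¬c → ¬∃ (l′ , l′⊆ , λ c → ¬c (C-anti l⊆xl′ c)))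

  -- Comparability of K with the number of classes of an equivalence
  -- relation on V, from a maximal partial injection V / ~ → K.
  module Comparison {V : Set a} {K : Set a} (_~_ : V → V → Set b) (v₀ : V)
    (~-refl : ∀ {x} → x ~ x) (~-sym : ∀ {x y} → x ~ y → y ~ x)
    (~-trans : ∀ {x y z} → x ~ y → y ~ z → x ~ z) where

    private
      Compatible : V × K → V × K → Set _
      Compatible (x , k) (y , k′) = (x ~ y → k ≡ k′) × (k ≡ k′ → x ~ y)

      Compatible-sym : ∀ {p q} → Compatible p q → Compatible q p
      Compatible-sym (f , g) = (λ e → sym (f (~-sym e))) , (λ e → ~-sym (g (sym e)))

      Clique : List (V × K) → Set _
      Clique l = ∀ {p q} → p List∈.∈ l → q List∈.∈ l → Compatible p q

      Clique-[] : Clique []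
      Clique-[] ()

      Clique-anti : ∀ {l l′} → (∀ {p} → p List∈.∈ l → p List∈.∈ l′) → Clique l′ → Clique l
      Clique-anti l⊆l′ c p∈ q∈ = c (l⊆l′ p∈) (l⊆l′ q∈)

      open Tukey Clique (λ {p} {q} → Clique-[] {p} {q}) Clique-anti

      clique : ∀ {p q} → p ∈ᵇ top → q ∈ᵇ top → Compatible p q
      clique p∈ q∈ = top-good _ (p∈ ∷ q∈ ∷ []) (here refl) (there (here refl))

      fresh : ∀ x k → (∀ y → ¬ (y , k) ∈ᵇ top) → (∀ y k′ → (y , k′) ∈ᵇ top → ¬ x ~ y) →
              (x , k) ∈ᵇ top
      fresh x k k∉ x∉ = ¬¬-elim λ xk∉ →
        let l , l⊆ , ¬c = maximal (x , k) xk∉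
            new : ∀ {q} → q List∈.∈ l → Compatible (x , k) q
            new {y , k′} q∈ = let t = All.lookup l⊆ q∈ in
              (λ e → contradiction e (x∉ y k′ t)) ,
              (λ { refl → contradiction t (k∉ y) })
        in ¬c λ
          { (here refl) (here refl) → (λ _ → refl) , (λ _ → ~-refl)
          ; (here refl) (there q∈)  → new q∈
          ; (there p∈)  (here refl) → Compatible-sym (new p∈)
          ; (there p∈)  (there q∈)  → clique (All.lookup l⊆ p∈) (All.lookup l⊆ q∈)
          }

      value : (k : K) → Dec (∃[ x ] (x , k) ∈ᵇ top) → V
      value k (yes (x , _)) = x
      value k (no _)        = v₀

      value-∈ : ∀ {x k} (d : Dec (∃[ x ] (x , k) ∈ᵇ top)) → (x , k) ∈ᵇ top → x ~ value k d
      value-∈ (yes (y , y∈)) x∈ = proj₂ (clique x∈ y∈) refl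
      value-∈ (no ¬x)        x∈ = contradiction (_ , x∈) ¬x

    injects⊎covers : (Σ[ g ∈ (K → V) ] ∀ k k′ → g k ~ g k′ → k ≡ k′) ⊎
                     (Σ[ g ∈ (K → V) ] ∀ x → ∃[ k ] x ~ g k)
    injects⊎covers with lem (∀ k → ∃[ x ] (x , k) ∈ᵇ top)
    ... | yes onto = inj₁ ((λ k → proj₁ (onto k)) , λ k k′ →
                           proj₁ (clique (proj₂ (onto k)) (proj₂ (onto k′))))
    ... | no ¬onto =
      let k₀ , k₀∉ = ¬∀⇒∃¬ ¬onto
      in inj₂ ((λ k → value k (lem _)) , λ x → ¬¬-elim λ ¬∃ →
           let x∉ : ∀ y k → (y , k) ∈ᵇ top → ¬ x ~ y
               x∉ y k yk∈ x~y = ¬∃ (k , ~-trans x~y (value-∈ (lem _) yk∈))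
           in k₀∉ (x , fresh x k₀ (λ y yk∈ → k₀∉ (y , yk∈)) x∉))

-- Comparison of ordinals and of rank values.

module OrdinalProperties (em : ∀ {a} → ExcludedMiddle a) (ext : ∀ {a b} → Extensionality a b) {ℓ : Level} where
  open Classical em ext

  private
    variable
      α β γ : Ordinal ℓ

  -- If `h x` were below `x`, iterating `h` would give an infinite descent.
  monotone⇒inflationary : ∀ (α : Ordinal ℓ) {h} → Monotone α α h → ∀ x → ¬ Ordinal._<_ α (h x) x
  monotone⇒inflationary α {h} mono x = go (Ordinal.wellFounded α x)
    where
    go : ∀ {x} → Acc (Ordinal._<_ α) x → ¬ Ordinal._<_ α (h x) x
    go (acc rs) hx<x = go (rs hx<x) (mono hx<x)

  ≤ᵒ-trans : α ≤ᵒ β → β ≤ᵒ γ → α ≤ᵒ γ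
  ≤ᵒ-trans {α} {β} {γ} (f , f-mono , f-init) (g , g-mono , g-init) =
    g ∘ f , (λ x<y → g-mono (f-mono x<y)) , init
    where
    init : ∀ {x y} → Ordinal._<_ γ y (g (f x)) → ∃[ x′ ] g (f x′) ≡ y
    init y< with g-init y<
    ... | z , refl with f-init (<-reflect y<)
      where
      open IsStrictTotalOrder (Ordinal.isStrictTotalOrder β)
      module Γ = IsStrictTotalOrder (Ordinal.isStrictTotalOrder γ)
      <-reflect : ∀ {x y} → Ordinal._<_ γ (g x) (g y) → Ordinal._<_ β x y
      <-reflect {x} {y} gx<gy with compare x y
      ... | tri< x<y _ _    = x<y
      ... | tri≈ _ refl _   = ⊥-elim (Γ.irrefl refl gx<gy)
      ... | tri> _ _ y<x    = ⊥-elim (Γ.irrefl refl (Γ.trans gx<gy (g-mono y<x)))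
    ...   | x′ , refl = x′ , refl

  ≈ᵒ⇒≤ᵒ : α ≈ᵒ β → α ≤ᵒ β
  ≈ᵒ⇒≤ᵒ (f , iso) = f , mono , λ {x} {y} _ → proj₁ (surjective y) , proj₂ (surjective y) refl
    where
    open IsOrderIsomorphism iso using (mono; surjective)

  ≈ᵒ⇒≥ᵒ : α ≈ᵒ β → β ≤ᵒ α
  ≈ᵒ⇒≥ᵒ {α} {β} (f , iso) = f⁻¹ , mono , λ {x} {y} _ → f y , injective (f-f⁻¹ (f y))
    where
    open IsOrderIsomorphism iso using (injective; cancel; surjective)

    f⁻¹ : Ordinal.Carrier β → Ordinal.Carrier α
    f⁻¹ y = proj₁ (surjective y)

    f-f⁻¹ : ∀ y → f (f⁻¹ y) ≡ y
    f-f⁻¹ y = proj₂ (surjective y) refl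

    mono : Monotone β α f⁻¹
    mono x<y = cancel (subst₂ (Ordinal._<_ β) (sym (f-f⁻¹ _)) (sym (f-f⁻¹ _)) x<y)

  -- The composite of the two embeddings would be a monotone self-map of `β` sending `z` below
  -- itself.
  <ᵒ⇒≱ᵒ : α <ᵒ β → ¬ β ≤ᵒ α
  <ᵒ⇒≱ᵒ {α} {β} (f , z , f-mono , below) (g , g-mono , _) =
    monotone⇒inflationary β {f ∘ g} (λ x<y → f-mono (g-mono x<y)) z
      (Equivalence.from (below _) (g z , refl))

  -- If the embedding is not onto, take the least element outside its image; as the image is
  -- downward closed, it is exactly the segment below that element.
  ≤ᵒ⇒≈ᵒ⊎<ᵒ : α ≤ᵒ β → α ≈ᵒ β ⊎ α <ᵒ β
  ≤ᵒ⇒≈ᵒ⊎<ᵒ {α} {β} (f , mono , init) with lem (∀ y → ∃[ x ] f x ≡ y)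
  ... | yes onto = inj₁ (f , record
      { isOrderMonomorphism = record
        { isOrderHomomorphism = record { cong = cong f ; mono = mono }
        ; injective = injective
        ; cancel    = cancel
        }
      ; surjective = λ y → proj₁ (onto y) , λ { refl → proj₂ (onto y) }
      })
    where
    module 𝛼 = IsStrictTotalOrder (Ordinal.isStrictTotalOrder α)
    module 𝛽 = IsStrictTotalOrder (Ordinal.isStrictTotalOrder β)

    injective : ∀ {x y} → f x ≡ f y → x ≡ y
    injective {x} {y} e with 𝛼.compare x y
    ... | tri< x<y _ _ = ⊥-elim (𝛽.irrefl e (mono x<y))
    ... | tri≈ _ x≡y _ = x≡y
    ... | tri> _ _ y<x = ⊥-elim (𝛽.irrefl (sym e) (mono y<x))

    cancel : ∀ {x y} → Ordinal._<_ β (f x) (f y) → Ordinal._<_ α x y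
    cancel {x} {y} fx<fy with 𝛼.compare x y
    ... | tri< x<y _ _  = x<y
    ... | tri≈ _ refl _ = ⊥-elim (𝛽.irrefl refl fx<fy)
    ... | tri> _ _ y<x  = ⊥-elim (𝛽.irrefl refl (𝛽.trans fx<fy (mono y<x)))
  ... | no ¬onto =
      let y , y∉ = ¬∀⇒∃¬ ¬onto
          z , z∉ , least = leastOutside (Ordinal.wellFounded β y) y∉
      in inj₂ (f , z , mono , λ y → mk⇔ (least y) λ { (x , refl) → f<z z∉ })
    where
    module 𝛽 = IsStrictTotalOrder (Ordinal.isStrictTotalOrder β)

    Image : Ordinal.Carrier β → Set ℓ
    Image y = ∃[ x ] f x ≡ y

    leastOutside : ∀ {y} → Acc (Ordinal._<_ β) y → ¬ Image y →
                   ∃[ z ] ¬ Image z × (∀ y → Ordinal._<_ β y z → Image y)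
    leastOutside {y} (acc rs) y∉ with lem (∃[ z ] Ordinal._<_ β z y × ¬ Image z)
    ... | yes (z , z<y , z∉) = leastOutside (rs z<y) z∉
    ... | no ¬z = y , y∉ , λ z z<y → ¬¬-elim λ z∉ → ¬z (z , z<y , z∉)

    f<z : ∀ {z x} → ¬ Image z → Ordinal._<_ β (f x) z
    f<z {z} {x} z∉ with 𝛽.compare (f x) z
    ... | tri< fx<z _ _ = fx<z
    ... | tri≈ _ fx≡z _ = ⊥-elim (z∉ (x , fx≡z))
    ... | tri> _ _ z<fx = ⊥-elim (z∉ (init z<fx))

  private
    variable
      r s t : Ord∞ ℓ

  ≤∞-trans : r ≤∞ s → s ≤∞ t → r ≤∞ t
  ≤∞-trans = ≤⁺-trans _ (λ {α} {β} {γ} → ≤ᵒ-trans {α} {β} {γ})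

  ≈∞⇒≤∞ : r ≈∞ s → r ≤∞ s
  ≈∞⇒≤∞ ⊤≈⊤ = ⊤⁺ ≤⊤⁺
  ≈∞⇒≤∞ ([_]≈ {α} {β} e) = [ ≈ᵒ⇒≤ᵒ {α} {β} e ]≤

  ≈∞⇒≥∞ : r ≈∞ s → s ≤∞ r
  ≈∞⇒≥∞ ⊤≈⊤ = ⊤⁺ ≤⊤⁺
  ≈∞⇒≥∞ ([_]≈ {α} {β} e) = [ ≈ᵒ⇒≥ᵒ {α} {β} e ]≤

  <∞⇒≱∞ : r <∞ s → ¬ s ≤∞ r
  <∞⇒≱∞ ([_]< {α} {β} α<β) [ β≤α ]≤ = <ᵒ⇒≱ᵒ {α} {β} α<β β≤α
  <∞⇒≱∞ [ _ ]<⊤⁺ ()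

  ≤∞∧≱∞⇒<∞ : r ≤∞ s → ¬ s ≤∞ r → r <∞ s
  ≤∞∧≱∞⇒<∞ ([_]≤ {α} {β} α≤β) β≰α with ≤ᵒ⇒≈ᵒ⊎<ᵒ {α} {β} α≤β
  ... | inj₁ α≈β = ⊥-elim (β≰α [ ≈ᵒ⇒≥ᵒ {α} {β} α≈β ]≤)
  ... | inj₂ α<β = [ α<β ]<
  ≤∞∧≱∞⇒<∞ ([ α ] ≤⊤⁺) β≰α = [ α ]<⊤⁺
  ≤∞∧≱∞⇒<∞ (⊤⁺ ≤⊤⁺)    β≰α = ⊥-elim (β≰α (⊤⁺ ≤⊤⁺))

  ≤∞-antisym : r ≤∞ s → s ≤∞ r → r ≈∞ s
  ≤∞-antisym ([_]≤ {α} {β} α≤β) [ β≤α ]≤ with ≤ᵒ⇒≈ᵒ⊎<ᵒ {α} {β} α≤β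
  ... | inj₁ α≈β = [ α≈β ]≈
  ... | inj₂ α<β = ⊥-elim (<ᵒ⇒≱ᵒ {α} {β} α<β β≤α)
  ≤∞-antisym (⊤⁺ ≤⊤⁺) _ = ⊤≈⊤

  ≤∞-<∞-trans : r ≤∞ s → s <∞ ∞ → r <∞ ∞
  ≤∞-<∞-trans [ _ ]≤ [ _ ]<⊤⁺ = [ _ ]<⊤⁺

-- Finite trees and their unique readability.

data Tree {ℓ} (Op : ℕ → Set ℓ) : Set ℓ where
  node : ∀ {k} → Op k → Vec (Tree Op) k → Tree Op

module _ {ℓ : Level} {Op : ℕ → Set ℓ} where

  node⁻¹ : ∀ {k k′} {o : Op k} {o′ : Op k′} {ts ts′} → node o ts ≡ node o′ ts′ →
           Σ[ e ∈ k ≡ k′ ] subst Op e o ≡ o′ × subst (Vec (Tree Op)) e ts ≡ ts′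
  node⁻¹ refl = refl , refl , refl

  mutual
    polish : Tree Op → List (Σ ℕ Op)
    polish (node {k} o ts) = (k , o) ∷ polishes ts

    polishes : ∀ {k} → Vec (Tree Op) k → List (Σ ℕ Op)
    polishes []       = []
    polishes (t ∷ ts) = polish t List.++ polishes ts

  mutual
    -- A symbol carries its arity, so a word in Polish notation shows where its first tree ends. The
    -- remainders `r` and `r′` carry the induction through lists of subtrees.
    polish-cancel : ∀ t t′ {r r′} → polish t List.++ r ≡ polish t′ List.++ r′ → t ≡ t′ × r ≡ r′
    polish-cancel (node o ts) (node o′ ts′) e with ∷-injective e
    ... | refl , e′ with polishes-cancel ts ts′ e′
    ...   | refl , e″ = refl , e″

    polishes-cancel : ∀ {k} (ts ts′ : Vec (Tree Op) k) {r r′} →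
                      polishes ts List.++ r ≡ polishes ts′ List.++ r′ → ts ≡ ts′ × r ≡ r′
    polishes-cancel []       []         e = refl , e
    polishes-cancel (t ∷ ts) (t′ ∷ ts′) {r} {r′} e
      with polish-cancel t t′ (trans (sym (++-assoc (polish t) _ r))
                                     (trans e (++-assoc (polish t′) _ r′)))
    ... | refl , e′ with polishes-cancel ts ts′ e′
    ...   | refl , e″ = refl , e″

  polish-injective : ∀ {t t′} → polish t ≡ polish t′ → t ≡ t′
  polish-injective {t} {t′} e = proj₁ (polish-cancel t t′ (cong (List._++ []) e))

-- Closure properties of small sets, and the number of formulas.

module Smallness (em : ∀ {a} → ExcludedMiddle a) (ext : ∀ {a b} → Extensionality a b)
  {ℓ : Level} (κ̄ : Set ℓ) (inaccessible : StronglyInaccessible κ̄) where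
  open Classical em ext
  open StronglyInaccessible inaccessible

  private
    variable
      a b : Level
      X : Set a
      Y : Set b

  Sm : Set a → Set _
  Sm X = setoid X <ᶜ setoid κ̄

  ↣-small : ∀ {s} {Z : Setoid a s} → Injection Z (setoid Y) → Sm Y → Z <ᶜ setoid κ̄
  ↣-small Z↣Y (Y↣κ , κ↣̸Y) = (Z↣Y ↣-∘ Y↣κ) , λ κ↣Z → κ↣̸Y (κ↣Z ↣-∘ Z↣Y)

  injective-small : (f : X → Y) → (∀ {x y} → f x ≡ f y → x ≡ y) → Sm Y → Sm X
  injective-small f inj = ↣-small (record { to = f ; cong = cong f ; injective = inj })

  ℕ-small : Sm ℕ
  ℕ-small = uncountable

  Fin-small : ∀ {n} → Sm (Fin n)
  Fin-small = injective-small toℕ toℕ-injective ℕ-small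

  Σ-small : {I : Set ℓ} {F : I → Set ℓ} → Sm I → (∀ i → Sm (F i)) → Sm (Σ I F)
  Σ-small = regular _ _

  ×-small : {X Y : Set ℓ} → Sm X → Sm Y → Sm (X × Y)
  ×-small x y = Σ-small x (λ _ → y)

  Lift-small : Sm X → Sm (Lift a X)
  Lift-small = injective-small lower (λ { {lift _} {lift _} refl → refl })

  Σℕ-small : {F : ℕ → Set ℓ} → (∀ n → Sm (F n)) → Sm (Σ ℕ F)
  Σℕ-small {F} small = injective-small {Y = Σ (Lift ℓ ℕ) (F ∘ lower)}
    (λ (n , x) → lift n , x) (λ { refl → refl }) (Σ-small (Lift-small ℕ-small) (small ∘ lower))

  ⊎-small : {X Y : Set ℓ} → Sm X → Sm Y → Sm (X ⊎ Y)
  ⊎-small {X} {Y} x y = injective-small {Y = Σ (Lift ℓ (Fin 2)) F}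
    (λ { (inj₁ x) → lift zero , x ; (inj₂ y) → lift (suc zero) , y })
    (λ { {inj₁ _} {inj₁ _} refl → refl ; {inj₂ _} {inj₂ _} refl → refl })
    (Σ-small (Lift-small Fin-small) λ { (lift zero) → x ; (lift (suc zero)) → y })
    where
    F : Lift ℓ (Fin 2) → Set ℓ
    F (lift zero)    = X
    F (lift (suc _)) = Y

  ⊎Fin-small : ∀ {m} {X : Set ℓ} → Sm X → Sm (X ⊎ Fin m)
  ⊎Fin-small {m} {X} x = injective-small {Y = X ⊎ Lift ℓ (Fin m)}
    (λ { (inj₁ x) → inj₁ x ; (inj₂ i) → inj₂ (lift i) })
    (λ { {inj₁ _} {inj₁ _} refl → refl ; {inj₂ _} {inj₂ _} refl → refl })
    (⊎-small x (Lift-small Fin-small))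

  Vec-small : {X : Set ℓ} → Sm X → ∀ n → Sm (Vec X n)
  Vec-small x zero    = injective-small {Y = Fin 1} (λ _ → zero) (λ { {[]} {[]} _ → refl }) Fin-small
  Vec-small x (suc n) = injective-small (λ { (y ∷ ys) → y , ys })
    (λ { {_ ∷ _} {_ ∷ _} refl → refl }) (×-small x (Vec-small x n))

  List-small : {X : Set ℓ} → Sm X → Sm (List X)
  List-small x = injective-small (λ l → List.length l , Vec.fromList l) fromList-injective
                                 (Σℕ-small (Vec-small x))
    where
    fromList-injective : ∀ {l l′} → _≡_ {A = Σ ℕ (Vec _)} (List.length l , Vec.fromList l)
                                        (List.length l′ , Vec.fromList l′) → l ≡ l′
    fromList-injective {l} {l′} e =
      trans (sym (toList∘fromList l)) (trans (cong (λ (_ , v) → Vec.toList v) e) (toList∘fromList l′))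

  Tree-small : {Op : ℕ → Set ℓ} → Sm (Σ ℕ Op) → Sm (Tree Op)
  Tree-small op = injective-small polish polish-injective (List-small op)

  -- `strongLimit` compares functions pointwise; `ext` turns this into propositional equality.
  powerset-small : {X : Set ℓ} → Sm X → Sm (X → Bool)
  powerset-small x =
    let P↣κ , κ↣̸P = strongLimit _ x
    in record { to        = Injection.to P↣κ
              ; cong      = cong _
              ; injective = λ e → ext (Injection.injective P↣κ e)
              }
     , λ κ↣P → κ↣̸P (record
              { to        = Injection.to κ↣P
              ; cong      = λ { refl _ → refl }
              ; injective = λ e → Injection.injective κ↣P (ext e)
              })

  module _ {C : Set ℓ} where

    -- A predicate may have many proofs; its truth value has at most one.
    Elements : Pred C ℓ → Set ℓ
    Elements A = ∃[ x ] ⌊ A x ⌋ ≡ true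

    Elements-small : {A : Pred C ℓ} → subset (setoid C) A <ᶜ setoid κ̄ → Sm (Elements A)
    Elements-small {A} (A↣κ , κ↣̸A) =
      (Elements↣A ↣-∘ A↣κ) , λ κ↣E → κ↣̸A (κ↣E ↣-∘ Elements↣A)
      where
      Elements↣A : Injection (setoid (Elements A)) (subset (setoid C) A)
      Elements↣A = record
        { to        = λ (x , p) → x , ⌊⌋-elim p
        ; cong      = λ { refl → refl }
        ; injective = λ { {x , p} {.x , p′} refl → cong (x ,_) (uip p p′) }
        }

    -- The index found for `x` may depend on the proof of membership, so the labelling is first
    -- repaired by `separating⇒Injection`.
    covered-small : {A : Pred C ℓ} (Y : Set ℓ) (e : Y → C) → Sm Y →
                    (∀ {x} → x ∈ A → ∃[ y ] e y ≡ x) → subset (setoid C) A <ᶜ setoid κ̄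
    covered-small {A} Y e y cover = ↣-small
      (separating⇒Injection (subset (setoid C) A) (λ (x , x∈A) → proj₁ (cover x∈A))
        (λ (x , x∈A) (x′ , x′∈A) eq →
          trans (sym (proj₂ (cover x∈A))) (trans (cong e eq) (proj₂ (cover x′∈A)))))
      y

    ∪-small : {A B : Pred C ℓ} → subset (setoid C) A <ᶜ setoid κ̄ → subset (setoid C) B <ᶜ setoid κ̄ →
              subset (setoid C) (A ∪ B) <ᶜ setoid κ̄
    ∪-small {A} {B} a b = covered-small (Elements A ⊎ Elements B)
      (λ { (inj₁ (x , _)) → x ; (inj₂ (x , _)) → x })
      (⊎-small (Elements-small a) (Elements-small b))
      (λ { (inj₁ p) → inj₁ (_ , ⌊⌋-intro p) , refl ; (inj₂ p) → inj₂ (_ , ⌊⌋-intro p) , refl })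

  module _ (L : Language ℓ) (smallFun : Sm (Σ ℕ (Language.FunSym L)))
           (smallRel : Sm (Σ ℕ (Language.RelSym L))) where
    open Language L

    private
      -- Variables are recorded by number, so one type of trees serves for formulas with any number
      -- of free variables.
      data Symbol : ℕ → Set ℓ where
        varˢ     : ℕ → Symbol 0
        funˢ     : ∀ {k} → FunSym k → Symbol k
        relˢ     : ∀ {k} → RelSym k → Symbol k
        ≈ˢ ⇒ˢ    : Symbol 2
        ⊥ˢ       : Symbol 0
        ∀ˢ       : Symbol 1

      Symbol-small : Sm (Σ ℕ Symbol)
      Symbol-small = injective-small
        {Y = Lift ℓ ℕ ⊎ (Σ ℕ FunSym ⊎ (Σ ℕ RelSym ⊎ Lift ℓ (Fin 4)))} code code-injective
        (⊎-small (Lift-small ℕ-small)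
                 (⊎-small smallFun (⊎-small smallRel (Lift-small Fin-small))))
        where
        code : Σ ℕ Symbol → Lift ℓ ℕ ⊎ (Σ ℕ FunSym ⊎ (Σ ℕ RelSym ⊎ Lift ℓ (Fin 4)))
        code (_ , varˢ i) = inj₁ (lift i)
        code (_ , funˢ f) = inj₂ (inj₁ (_ , f))
        code (_ , relˢ r) = inj₂ (inj₂ (inj₁ (_ , r)))
        code (_ , ≈ˢ)     = inj₂ (inj₂ (inj₂ (lift zero)))
        code (_ , ⇒ˢ)     = inj₂ (inj₂ (inj₂ (lift (suc zero))))
        code (_ , ⊥ˢ)     = inj₂ (inj₂ (inj₂ (lift (suc (suc zero)))))
        code (_ , ∀ˢ)     = inj₂ (inj₂ (inj₂ (lift (suc (suc (suc zero))))))

        code-injective : ∀ {s t} → code s ≡ code t → s ≡ t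
        code-injective {_ , varˢ _} {_ , varˢ _} refl = refl
        code-injective {_ , funˢ _} {_ , funˢ _} refl = refl
        code-injective {_ , relˢ _} {_ , relˢ _} refl = refl
        code-injective {_ , ≈ˢ} {_ , ≈ˢ} refl = refl
        code-injective {_ , ⇒ˢ} {_ , ⇒ˢ} refl = refl
        code-injective {_ , ⊥ˢ} {_ , ⊥ˢ} refl = refl
        code-injective {_ , ∀ˢ} {_ , ∀ˢ} refl = refl

      mutual
        termTree : ∀ {n} → Term L n → Tree Symbol
        termTree (var i)    = node (varˢ (toℕ i)) []
        termTree (app f ts) = node (funˢ f) (termTrees ts)

        termTrees : ∀ {n k} → Vec (Term L n) k → Vec (Tree Symbol) k
        termTrees []       = []
        termTrees (t ∷ ts) = termTree t ∷ termTrees ts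

      mutual
        termTree-injective : ∀ {n} (s t : Term L n) → termTree s ≡ termTree t → s ≡ t
        termTree-injective (var i) (var j) e with node⁻¹ e
        ... | refl , e′ , _ = cong var (toℕ-injective (varˢ-injective e′))
          where
          varˢ-injective : ∀ {i j} → varˢ i ≡ varˢ j → i ≡ j
          varˢ-injective refl = refl
        termTree-injective (var i) (app f ts) e with node⁻¹ e
        ... | refl , () , _
        termTree-injective (app f ts) (var i) e with node⁻¹ e
        ... | refl , () , _
        termTree-injective (app f ts) (app g us) e with node⁻¹ e
        ... | refl , refl , e′ = cong (app f) (termTrees-injective ts us e′)

        termTrees-injective : ∀ {n k} (ts us : Vec (Term L n) k) → termTrees ts ≡ termTrees us → ts ≡ us
        termTrees-injective []       []       e = refl
        termTrees-injective (t ∷ ts) (u ∷ us) e =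
          cong₂ _∷_ (termTree-injective t u (cong Vec.head e)) (termTrees-injective ts us (cong Vec.tail e))

      formulaTree : ∀ {n} → Formula L n → Tree Symbol
      formulaTree (rel r ts) = node (relˢ r) (termTrees ts)
      formulaTree (s ≈′ t)   = node ≈ˢ (termTree s ∷ termTree t ∷ [])
      formulaTree ⊥′         = node ⊥ˢ []
      formulaTree (φ ⇒′ ψ)   = node ⇒ˢ (formulaTree φ ∷ formulaTree ψ ∷ [])
      formulaTree (∀′ φ)     = node ∀ˢ (formulaTree φ ∷ [])

      formulaTree-injective : ∀ {n} (φ ψ : Formula L n) → formulaTree φ ≡ formulaTree ψ → φ ≡ ψ
      formulaTree-injective (rel r ts) (rel r′ us) e with node⁻¹ e
      ... | refl , refl , e′ = cong (rel r) (termTrees-injective ts us e′)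
      formulaTree-injective (s ≈′ t) (s′ ≈′ t′) e with node⁻¹ e
      ... | refl , _ , e′ = cong₂ _≈′_ (termTree-injective s s′ (cong Vec.head e′))
                                       (termTree-injective t t′ (cong (Vec.head ∘ Vec.tail) e′))
      formulaTree-injective ⊥′ ⊥′ e = refl
      formulaTree-injective (φ ⇒′ ψ) (φ′ ⇒′ ψ′) e with node⁻¹ e
      ... | refl , _ , e′ = cong₂ _⇒′_ (formulaTree-injective φ φ′ (cong Vec.head e′))
                                       (formulaTree-injective ψ ψ′ (cong (Vec.head ∘ Vec.tail) e′))
      formulaTree-injective (∀′ φ) (∀′ ψ) e with node⁻¹ e
      ... | refl , _ , e′ = cong ∀′ (formulaTree-injective φ ψ (cong Vec.head e′))
      formulaTree-injective (rel r ts) (s′ ≈′ t′) e with node⁻¹ e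
      ... | refl , () , _
      formulaTree-injective (rel r ts) ⊥′ e with node⁻¹ e
      ... | refl , () , _
      formulaTree-injective (rel r ts) (φ′ ⇒′ ψ′) e with node⁻¹ e
      ... | refl , () , _
      formulaTree-injective (rel r ts) (∀′ ψ) e with node⁻¹ e
      ... | refl , () , _
      formulaTree-injective (s ≈′ t) (rel r ts) e with node⁻¹ e
      ... | refl , () , _
      formulaTree-injective ⊥′ (rel r ts) e with node⁻¹ e
      ... | refl , () , _
      formulaTree-injective (φ ⇒′ ψ) (rel r ts) e with node⁻¹ e
      ... | refl , () , _
      formulaTree-injective (∀′ φ) (rel r ts) e with node⁻¹ e
      ... | refl , () , _

    Formula-small : ∀ {n} → Sm (Formula L n)
    Formula-small = injective-small formulaTree (formulaTree-injective _ _) (Tree-small Symbol-small)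

-- Renaming of variables and blocks of quantifiers.

module _ {L : Language ℓ} where

  mutual
    renameᵗ : ∀ {k l} → (Fin k → Fin l) → Term L k → Term L l
    renameᵗ ρ (var i)    = var (ρ i)
    renameᵗ ρ (app f ts) = app f (renameᵗˢ ρ ts)

    renameᵗˢ : ∀ {k l j} → (Fin k → Fin l) → Vec (Term L k) j → Vec (Term L l) j
    renameᵗˢ ρ []       = []
    renameᵗˢ ρ (t ∷ ts) = renameᵗ ρ t ∷ renameᵗˢ ρ ts

  rename : ∀ {k l} → (Fin k → Fin l) → Formula L k → Formula L l
  rename ρ (rel r ts) = rel r (renameᵗˢ ρ ts)
  rename ρ (s ≈′ t)   = renameᵗ ρ s ≈′ renameᵗ ρ t
  rename ρ ⊥′         = ⊥′
  rename ρ (φ ⇒′ ψ)   = rename ρ φ ⇒′ rename ρ ψ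
  rename ρ (∀′ φ)     = ∀′ (rename (Fin.lift 1 ρ) φ)

  ∀′^ : ∀ m {r} → Formula L (m + r) → Formula L r
  ∀′^ zero    φ = φ
  ∀′^ (suc m) φ = ∀′^ m (∀′ φ)

  module _ (M : Structure L) where
    open Structure M

    mutual
      eval-rename : ∀ {k l} (ρ : Fin k → Fin l) v w → (∀ i → lookup w (ρ i) ≡ lookup v i) →
                    ∀ t → eval M w (renameᵗ ρ t) ≡ eval M v t
      eval-rename ρ v w h (var i)    = h i
      eval-rename ρ v w h (app f ts) = cong (funᴹ f) (evals-rename ρ v w h ts)

      evals-rename : ∀ {k l} (ρ : Fin k → Fin l) v w → (∀ i → lookup w (ρ i) ≡ lookup v i) →
                     ∀ {j} (ts : Vec _ j) → evals M w (renameᵗˢ ρ ts) ≡ evals M v ts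
      evals-rename ρ v w h []       = refl
      evals-rename ρ v w h (t ∷ ts) = cong₂ _∷_ (eval-rename ρ v w h t) (evals-rename ρ v w h ts)

    ⊨-rename : ∀ {k l} (ρ : Fin k → Fin l) v w → (∀ i → lookup w (ρ i) ≡ lookup v i) →
               ∀ φ → M ⊨ rename ρ φ [ w ] ⇔ M ⊨ φ [ v ]
    ⊨-rename ρ v w h (rel r ts) = mk⇔ (subst (relᴹ r) (evals-rename ρ v w h ts))
                                      (subst (relᴹ r) (sym (evals-rename ρ v w h ts)))
    ⊨-rename ρ v w h (s ≈′ t) = mk⇔
      (subst₂ _≡_ (eval-rename ρ v w h s) (eval-rename ρ v w h t))
      (subst₂ _≡_ (sym (eval-rename ρ v w h s)) (sym (eval-rename ρ v w h t)))
    ⊨-rename ρ v w h ⊥′ = mk⇔ id id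
    ⊨-rename ρ v w h (φ ⇒′ ψ) = mk⇔
      (λ f p → Equivalence.to (⊨-rename ρ v w h ψ) (f (Equivalence.from (⊨-rename ρ v w h φ) p)))
      (λ f p → Equivalence.from (⊨-rename ρ v w h ψ) (f (Equivalence.to (⊨-rename ρ v w h φ) p)))
    ⊨-rename ρ v w h (∀′ φ) = mk⇔
      (λ f x → Equivalence.to (body x) (f x)) (λ f x → Equivalence.from (body x) (f x))
      where
      body : ∀ x → M ⊨ rename (Fin.lift 1 ρ) φ [ x ∷ w ] ⇔ M ⊨ φ [ x ∷ v ]
      body x = ⊨-rename (Fin.lift 1 ρ) (x ∷ v) (x ∷ w) (λ { zero → refl ; (suc i) → h i }) φ

    ⊨-∀′^ : ∀ m {r} (φ : Formula L (m + r)) v →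
            M ⊨ ∀′^ m φ [ v ] ⇔ (∀ (x : Vec Carrier m) → M ⊨ φ [ x ++ v ])
    ⊨-∀′^ zero    φ v = mk⇔ (λ { p [] → p }) (λ p → p [])
    ⊨-∀′^ (suc m) φ v = mk⇔
      (λ { p (x ∷ xs) → Equivalence.to (⊨-∀′^ m (∀′ φ) v) p xs x })
      (λ p → Equivalence.from (⊨-∀′^ m (∀′ φ) v) (λ xs x → p (x ∷ xs)))

-- Implications between formulas with parameters.

module _ {L : Language ℓ} {M : Structure L} where
  open Structure M using (Carrier)
  open ParamFormula

  -- The variables of φ(x,a) and of ψ(x,b), placed among those of a
  -- formula in (x,a,b)
  private
    injˡ : ∀ m r s → Fin (m + r) → Fin (m + (r + s))
    injˡ m r s i = [ _↑ˡ (r + s) , (λ j → m ↑ʳ (j ↑ˡ s)) ]′ (splitAt m i)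

    injʳ : ∀ m r s → Fin (m + s) → Fin (m + (r + s))
    injʳ m r s i = [ _↑ˡ (r + s) , (λ j → m ↑ʳ (r ↑ʳ j)) ]′ (splitAt m i)

  infixr 5 _⇒ᵖ_

  _⇒ᵖ_ : ∀ {m} → ParamFormula M m → ParamFormula M m → ParamFormula M m
  _⇒ᵖ_ {m} (_⟨_⟩ {r} φ a) (_⟨_⟩ {s} ψ b) =
    (rename (injˡ m r s) φ ⇒′ rename (injʳ m r s) ψ) ⟨ a ++ b ⟩

  ⊩-⇒ᵖ : ∀ {m} (x : Vec Carrier m) φ ψ → x ⊩ (φ ⇒ᵖ ψ) ⇔ (x ⊩ φ → x ⊩ ψ)
  ⊩-⇒ᵖ {m} x (_⟨_⟩ {r} φ a) (_⟨_⟩ {s} ψ b) = mk⇔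
    (λ f p → Equivalence.to eqʳ (f (Equivalence.from eqˡ p)))
    (λ f p → Equivalence.from eqʳ (f (Equivalence.to eqˡ p)))
    where
    atˡ : ∀ i → lookup (x ++ (a ++ b)) (injˡ m r s i) ≡ lookup (x ++ a) i
    atˡ i rewrite lookup-splitAt m x a i with splitAt m i
    ... | inj₁ j = lookup-++ˡ x (a ++ b) j
    ... | inj₂ j = trans (lookup-++ʳ x (a ++ b) (j ↑ˡ s)) (lookup-++ˡ a b j)

    atʳ : ∀ i → lookup (x ++ (a ++ b)) (injʳ m r s i) ≡ lookup (x ++ b) i
    atʳ i rewrite lookup-splitAt m x b i with splitAt m i
    ... | inj₁ j = lookup-++ˡ x (a ++ b) j
    ... | inj₂ j = trans (lookup-++ʳ x (a ++ b) (r ↑ʳ j)) (lookup-++ʳ a b j)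

    eqˡ = ⊨-rename M (injˡ m r s) (x ++ a) (x ++ (a ++ b)) atˡ φ
    eqʳ = ⊨-rename M (injʳ m r s) (x ++ b) (x ++ (a ++ b)) atʳ ψ

  -- The negated conjunction of `Δ`, as an iterated implication ending in falsum.
  refutation : ∀ {m} → List (ParamFormula M m) → ParamFormula M m
  refutation []      = ⊥′ ⟨ [] ⟩
  refutation (φ ∷ Δ) = φ ⇒ᵖ refutation Δ

  refutation-over : ∀ {m} {A : Pred Carrier ℓ} (Δ : List (ParamFormula M m)) →
                    All (_Over A) Δ → refutation Δ Over A
  refutation-over []      []      = []
  refutation-over (φ ∷ Δ) (a ∷ h) = VecAllₚ.++⁺ a (refutation-over Δ h)

  refutation-sound : ∀ {m} (x : Vec Carrier m) Δ → x ⊩ refutation Δ → ¬ All (x ⊩_) Δ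
  refutation-sound x []      p []       = Poly.⊥-elim p
  refutation-sound x (φ ∷ Δ) p (q ∷ qs) =
    refutation-sound x Δ (Equivalence.to (⊩-⇒ᵖ x φ (refutation Δ)) p q) qs

  refutation-complete : ∀ {m} (x : Vec Carrier m) Δ → ¬ All (x ⊩_) Δ → x ⊩ refutation Δ
  refutation-complete x []      h = ⊥-elim (h [])
  refutation-complete x (φ ∷ Δ) h = Equivalence.from (⊩-⇒ᵖ x φ (refutation Δ))
    (λ p → refutation-complete x Δ (λ qs → h (p ∷ qs)))

-- Realization in elementary submodels, and completion of partial types.

module TypeConstruction (em : ∀ {a} → ExcludedMiddle a) (ext : ∀ {a b} → Extensionality a b)
  {L : Language ℓ} {M : Structure L} where
  open Classical em ext
  open Structure M using (Carrier)
  open ParamFormula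
  open S

  preimages : {I : Set ℓ} (e : I → Carrier) → ∀ {m} (v : Vec Carrier m) →
              v ∈ᵗ (λ x → ∃[ y ] e y ≡ x) → ∃[ u ] Vec.map e u ≡ v
  preimages e []      []             = [] , refl
  preimages e (_ ∷ v) ((y , p) ∷ ps) = let u , q = preimages e v ps in y ∷ u , cong₂ _∷_ p q

  module _ {N : Structure L} (N≼M : N ≼ M) where
    open _≼_ N≼M

    -- If no tuple of `N` refuted `χ`, its universal closure would hold in `N`, hence by
    -- elementarity in `M`, against `x`.
    refutedInSubmodel : ∀ {m} (χ : ParamFormula M m) → χ Over (λ x → ∃[ y ] embed y ≡ x) →
      (x : Vec Carrier m) → ¬ x ⊩ χ → ∃[ y ] ¬ Vec.map embed y ⊩ χ
    refutedInSubmodel {m} (χ ⟨ e ⟩) over x ¬χ with preimages embed e over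
    ... | u , refl = ¬¬-elim λ ¬∃ → ¬χ
      (Equivalence.to (⊨-∀′^ M m χ _) (Equivalence.to (elementary (∀′^ m χ) u)
        (Equivalence.from (⊨-∀′^ N m χ u) λ y → ¬¬-elim λ ¬q → ¬∃ (y , λ q → ¬q
          (Equivalence.from (elementary χ (y ++ u))
            (subst (λ w → M ⊨ χ [ w ]) (sym (map-++ embed y u)) q))))) x)

    realizedInSubmodel : ∀ {m} (Δ : List (ParamFormula M m)) → All (_Over (λ x → ∃[ y ] embed y ≡ x)) Δ →
      (x : Vec Carrier m) → All (x ⊩_) Δ → ∃[ y ] All (Vec.map embed y ⊩_) Δ
    realizedInSubmodel Δ over x p =
      let y , ¬r = refutedInSubmodel (refutation Δ) (refutation-over Δ over) x
                     (λ r → refutation-sound x Δ r p)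
      in y , ¬¬-elim λ ¬p → ¬r (refutation-complete _ Δ ¬p)

  -- The constraints Z stand for formulas such as φ(x,a) → φ(x,b), whose
  -- substitution instances then need not be constructed.
  lindenbaum : ∀ {n} (A : Pred Carrier ℓ) (Γ : Pred (ParamFormula M n) ℓ) → (∀ {φ} → φ ∈ Γ → φ Over A) →
    {Z : Set ℓ} (Sat : Vec Carrier n → Z → Set ℓ) →
    (∀ Δ Θ → All (_∈ Γ) Δ → ∃[ x ] All (x ⊩_) Δ × All (Sat x) Θ) →
    Σ[ r ∈ S M A n ] Γ ⊆ formulas r ×
      (∀ Δ Θ → All (_∈ formulas r) Δ → ∃[ x ] All (x ⊩_) Δ × All (Sat x) Θ)
  lindenbaum {n} A Γ Γ-over {Z} Sat satisfiable = r , (λ φ∈Γ → lift (Γ⊆ φ∈Γ)) , r-satisfiable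
    where
    -- Joint satisfiability with every finite part of `Γ` and of the constraints. These parts are
    -- quantified inside, so that only `Δ` varies in the maximality argument.
    C : List (ParamFormula M n) → Set ℓ
    C Δ = All (_Over A) Δ × (∀ Δ₀ Θ → All (_∈ Γ) Δ₀ →
            ∃[ x ] All (x ⊩_) Δ₀ × All (x ⊩_) Δ × All (Sat x) Θ)

    C-[] : C []
    C-[] = [] , λ Δ₀ Θ h → let x , p , q = satisfiable Δ₀ Θ h in x , p , [] , q

    C-anti : ∀ {Δ Δ′} → (∀ {φ} → φ List∈.∈ Δ → φ List∈.∈ Δ′) → C Δ′ → C Δ
    C-anti Δ⊆Δ′ (o , c) = All.tabulate (λ φ∈ → All.lookup o (Δ⊆Δ′ φ∈)) , λ Δ₀ Θ h →
      let x , p , p′ , q = c Δ₀ Θ h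
      in x , p , All.tabulate (λ φ∈ → All.lookup p′ (Δ⊆Δ′ φ∈)) , q

    open Tukey C C-[] C-anti

    Γ⊆ : ∀ {φ} → φ ∈ Γ → φ ∈ᵇ top
    Γ⊆ {φ} φ∈Γ = ¬¬-elim λ φ∉ →
      let Δ , Δ⊆ , ¬c = maximal φ φ∉
          o , c = top-good Δ Δ⊆
      in ¬c (Γ-over φ∈Γ ∷ o , λ Δ₀ Θ h →
           let x , p , p′ , q = c (φ ∷ Δ₀) Θ (φ∈Γ ∷ h) in x , All.tail p , All.head p ∷ p′ , q)

    obstruction : ∀ {φ} → φ Over A → ¬ φ ∈ᵇ top → ∃[ Δ ] ∃[ Δ₀ ] ∃[ Θ ]
      All (_∈ᵇ top) Δ × All (_∈ Γ) Δ₀ ×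
      (∀ x → All (x ⊩_) Δ₀ → All (x ⊩_) Δ → All (Sat x) Θ → ¬ x ⊩ φ)
    obstruction {φ} φ-over φ∉ =
      let Δ , Δ⊆ , ¬c = maximal φ φ∉
          o , _ = top-good Δ Δ⊆
      in ¬¬-elim λ ¬∃ → ¬c (φ-over ∷ o , λ Δ₀ Θ h → ¬¬-elim λ ¬x →
           ¬∃ (Δ , Δ₀ , Θ , Δ⊆ , h , λ x p p′ q xφ → ¬x (x , p , xφ ∷ p′ , q)))

    -- If neither were in `top`, the two obstructions could be pooled, and a tuple meeting all their
    -- conditions would satisfy neither `φ` nor its negation.
    decides : ∀ φ → φ Over A → φ ∈ᵇ top ⊎ (¬ᵖ φ) ∈ᵇ top
    decides φ φ-over with lem (φ ∈ᵇ top) | lem ((¬ᵖ φ) ∈ᵇ top)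
    ... | yes φ∈ | _       = inj₁ φ∈
    ... | no _   | yes ¬φ∈ = inj₂ ¬φ∈
    ... | no φ∉  | no ¬φ∉  =
      let Δ₁ , Γ₁ , Θ₁ , Δ₁⊆ , Γ₁⊆ , no₁ = obstruction {φ} φ-over φ∉
          Δ₂ , Γ₂ , Θ₂ , Δ₂⊆ , Γ₂⊆ , no₂ = obstruction {¬ᵖ φ} φ-over ¬φ∉
          x , p , p′ , q = proj₂ (top-good (Δ₁ List.++ Δ₂) (++⁺ Δ₁⊆ Δ₂⊆))
                                 (Γ₁ List.++ Γ₂) (Θ₁ List.++ Θ₂) (++⁺ Γ₁⊆ Γ₂⊆)
      in ⊥-elim (no₂ x (++⁻ʳ Γ₁ p) (++⁻ʳ Δ₁ p′) (++⁻ʳ Θ₁ q)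
           (λ xφ → ⊥-elim (no₁ x (++⁻ˡ Γ₁ p) (++⁻ˡ Δ₁ p′) (++⁻ˡ Θ₁ q) xφ)))

    r-satisfiable : ∀ Δ Θ → All (λ φ → Lift ℓ (φ ∈ᵇ top)) Δ → ∃[ x ] All (x ⊩_) Δ × All (Sat x) Θ
    r-satisfiable Δ Θ h =
      let x , _ , p , q = proj₂ (top-good Δ (All.map lower h)) [] Θ [] in x , p , q

    r : S M A n
    r = record
      { formulas   = λ φ → Lift ℓ (φ ∈ᵇ top)
      ; over       = λ {φ} φ∈ → All.head (proj₁ (top-good (φ ∷ []) (lower φ∈ ∷ [])))
      ; consistent = λ Δ h → let x , p , _ = r-satisfiable Δ [] h in x , p
      ; complete   = λ φ o → Sum.map lift lift (decides φ o)
      }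

lookup-ext : ∀ {a} {X : Set a} {m} {u v : Vec X m} → (∀ i → lookup u i ≡ lookup v i) → u ≡ v
lookup-ext {u = u} {v} h = trans (sym (tabulate∘lookup u)) (trans (tabulate-cong h) (tabulate∘lookup v))

-- Small models inside the monster and types over them.

module MonsterProperties (em : ∀ {a} → ExcludedMiddle a) (ext : ∀ {a b} → Extensionality a b)
  {ℓ : Level} {L : Language ℓ} {T : Theory L} (𝕄 : MonsterModel T) where
  open Classical em ext
  open MonsterModel 𝕄
  open Smallness em ext κ̄ inaccessible
  open Structure ℭ using (funᴹ; relᴹ; nonempty)
  open Language L
  open S

  module SkolemHull {A : Pred ∣ℭ∣ ℓ} (A-small : Small A) where

    data Operation : ℕ → Set ℓ where
      base   : Elements A → Operation 0
      fun    : ∀ {k} → FunSym k → Operation k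
      skolem : ∀ {k} → Formula L (suc k) → Operation k

    counterexample : ∀ {k} → Formula L (suc k) → Vec ∣ℭ∣ k → ∣ℭ∣
    counterexample φ v with lem (∃[ x ] ¬ ℭ ⊨ φ [ x ∷ v ])
    ... | yes (x , _) = x
    ... | no _        = nonempty

    counterexample-correct : ∀ {k} (φ : Formula L (suc k)) v →
      ℭ ⊨ φ [ counterexample φ v ∷ v ] → ℭ ⊨ ∀′ φ [ v ]
    counterexample-correct φ v h x with lem (∃[ x ] ¬ ℭ ⊨ φ [ x ∷ v ])
    ... | yes (_ , ¬h) = contradiction h ¬h
    ... | no ¬∃        = ¬¬-elim λ ¬p → ¬∃ (x , ¬p)

    mutual
      value : Tree Operation → ∣ℭ∣
      value (node (base (x , _)) _) = x
      value (node (fun f) ts)       = funᴹ f (values ts)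
      value (node (skolem φ) ts)    = counterexample φ (values ts)

      values : ∀ {k} → Vec (Tree Operation) k → Vec ∣ℭ∣ k
      values []       = []
      values (t ∷ ts) = value t ∷ values ts

    -- Elements rather than trees, with a truth value as proof: equality in the hull is then
    -- equality in `ℭ`.
    Hull : Set ℓ
    Hull = Elements (λ x → ∃[ t ] value t ≡ x)

    trees : ∀ {k} (v : Vec Hull k) → ∃[ ts ] values ts ≡ Vec.map proj₁ v
    trees []            = [] , refl
    trees ((x , p) ∷ v) = let t , e = ⌊⌋-elim p ; ts , e′ = trees v in t ∷ ts , cong₂ _∷_ e e′

    closed : ∀ {k} (o : Operation k) (F : Vec ∣ℭ∣ k → ∣ℭ∣) → (∀ ts → value (node o ts) ≡ F (values ts)) →
             Vec Hull k → Hull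
    closed o F h v = F (Vec.map proj₁ v) , ⌊⌋-intro
      (let ts , e = trees v in node o ts , trans (h ts) (cong F e))

    hull : Structure L
    hull = record
      { Carrier  = Hull
      -- The Skolem constant for falsum exists even if `A` is empty and the language has no
      -- constants.
      ; nonempty = closed (skolem ⊥′) (counterexample ⊥′) (λ _ → refl) []
      ; funᴹ     = λ f → closed (fun f) (funᴹ f) (λ _ → refl)
      ; relᴹ     = λ r v → relᴹ r (Vec.map proj₁ v)
      }

    mutual
      eval-hull : ∀ {n} (v : Vec Hull n) t → proj₁ (eval hull v t) ≡ eval ℭ (Vec.map proj₁ v) t
      eval-hull v (var i)    = sym (lookup-map i proj₁ v)
      eval-hull v (app f ts) = cong (funᴹ f) (evals-hull v ts)

      evals-hull : ∀ {n k} (v : Vec Hull n) (ts : Vec (Term L n) k) →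
                   Vec.map proj₁ (evals hull v ts) ≡ evals ℭ (Vec.map proj₁ v) ts
      evals-hull v []       = refl
      evals-hull v (t ∷ ts) = cong₂ _∷_ (eval-hull v t) (evals-hull v ts)

    Hull-≡ : ∀ {x y : Hull} → proj₁ x ≡ proj₁ y → x ≡ y
    Hull-≡ {x , p} {.x , q} refl = cong (x ,_) (uip p q)

    -- The Tarski-Vaught argument: for a quantifier, it suffices to test the Skolem counterexample,
    -- which lies in the hull.
    hull-elementary : ∀ {n} (φ : Formula L n) v → hull ⊨ φ [ v ] ⇔ ℭ ⊨ φ [ Vec.map proj₁ v ]
    hull-elementary (rel r ts) v = mk⇔ (subst (relᴹ r) (evals-hull v ts))
                                       (subst (relᴹ r) (sym (evals-hull v ts)))
    hull-elementary (s ≈′ t) v = mk⇔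
      (λ e → trans (sym (eval-hull v s)) (trans (cong proj₁ e) (eval-hull v t)))
      (λ e → Hull-≡ (trans (eval-hull v s) (trans e (sym (eval-hull v t)))))
    hull-elementary ⊥′ v = mk⇔ id id
    hull-elementary (φ ⇒′ ψ) v = mk⇔
      (λ h p → Equivalence.to (hull-elementary ψ v) (h (Equivalence.from (hull-elementary φ v) p)))
      (λ h p → Equivalence.from (hull-elementary ψ v) (h (Equivalence.to (hull-elementary φ v) p)))
    hull-elementary (∀′ φ) v = mk⇔
      (λ h → counterexample-correct φ _ (Equivalence.to (hull-elementary φ (c ∷ v)) (h c)))
      (λ h x → Equivalence.from (hull-elementary φ (x ∷ v)) (h (proj₁ x)))
      where
      c : Hull
      c = closed (skolem φ) (counterexample φ) (λ _ → refl) v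

    Operation-small : Sm (Σ ℕ Operation)
    Operation-small = injective-small
      {Y = Elements A ⊎ (Σ ℕ FunSym ⊎ Σ ℕ (Formula L ∘ suc))}
      (λ { (_ , base x) → inj₁ x ; (_ , fun f) → inj₂ (inj₁ (_ , f)) ; (_ , skolem φ) → inj₂ (inj₂ (_ , φ)) })
      (λ { {_ , base _} {_ , base _} refl → refl
         ; {_ , fun _} {_ , fun _} refl → refl
         ; {_ , skolem _} {_ , skolem _} refl → refl })
      (⊎-small (Elements-small A-small)
               (⊎-small smallFun (Σℕ-small (λ _ → Formula-small L smallFun smallRel))))

    model : SmallModelContaining 𝕄 A
    model = record
      { N        = hull
      ; N≼ℭ      = record { embed = proj₁ ; elementary = hull-elementary }
      ; small    = injective-small (λ (_ , p) → proj₁ (⌊⌋-elim p))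
          (λ { {_ , p} {_ , q} e → Hull-≡ (trans (sym (proj₂ (⌊⌋-elim p)))
                                           (trans (cong value e) (proj₂ (⌊⌋-elim q)))) })
          (Tree-small Operation-small)
      ; contains = λ {x} x∈A →
          (x , ⌊⌋-intro (node (base (x , ⌊⌋-intro x∈A)) [] , refl)) , refl
      }

  -- a ≡_N b, expressed with indices for the elements of N and the
  -- entries of the tuples.
  module OverModel {A : Pred ∣ℭ∣ ℓ} (𝑁 : SmallModelContaining 𝕄 A) where
    open SmallModelContaining 𝑁 public
    open _≼_ N≼ℭ public

    ∣N∣ : Set ℓ
    ∣N∣ = Structure.Carrier N

    assign : ∀ {m} → Vec ∣ℭ∣ m → ∣N∣ ⊎ Fin m → ∣ℭ∣
    assign a = [ embed , lookup a ]′

    infix 4 _≡ᴺ_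

    _≡ᴺ_ : ∀ {m} → Vec ∣ℭ∣ m → Vec ∣ℭ∣ m → Set ℓ
    a ≡ᴺ b = SameType (assign a) (assign b)

    conjugate : ∀ {m} {a b : Vec ∣ℭ∣ m} → a ≡ᴺ b →
      Σ[ f ∈ Aut ℭ ] FixesPointwise 𝕄 universe f × Vec.map (Aut.to f) a ≡ b
    conjugate {a = a} {b} a≡b =
      let f , h = homogeneous (⊎Fin-small small) (assign a) (assign b) a≡b
      in f , (λ { (y , refl) → h (inj₁ y) }) ,
         lookup-ext (λ i → trans (lookup-map i (Aut.to f) a) (h (inj₂ i)))

    -- A type over `N` as a table of truth values; each variable of a formula is filled by an
    -- element of `N` or an entry of the tuple.
    TypeCode : ℕ → Set ℓ
    TypeCode m = (Σ[ j ∈ ℕ ] Formula L j × Vec (∣N∣ ⊎ Fin m) j) → Bool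

    typeCode : ∀ {m} → Vec ∣ℭ∣ m → TypeCode m
    typeCode a (_ , φ , i) = ⌊ ℭ ⊨ φ [ Vec.map (assign a) i ] ⌋

    typeCode-≡⁻ : ∀ {m} {a b : Vec ∣ℭ∣ m} → typeCode a ≡ typeCode b → a ≡ᴺ b
    typeCode-≡⁻ e φ i = mk⇔ (⌊⌋-≡⁻ (cong-app e (_ , φ , i))) (⌊⌋-≡⁻ (sym (cong-app e (_ , φ , i))))

    TypeCode-small : ∀ m → Sm (TypeCode m)
    TypeCode-small m = powerset-small (Σℕ-small λ j →
      ×-small (Formula-small L smallFun smallRel) (Vec-small (⊎Fin-small small) j))

    -- An `N`-invariant global type is determined by the pairs of a formula φ(x,y) and a type over
    -- `N` of some `a` with φ(x,a) in it.
    GlobalCode : ℕ → Set ℓ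
    GlobalCode n = (Σ[ m ∈ ℕ ] Formula L (n + m) × TypeCode m) → Bool

    globalCode : ∀ {n} → GlobalType {M = ℭ} n → GlobalCode n
    globalCode 𝔮 (m , φ , c) = ⌊ (Σ[ a ∈ Vec ∣ℭ∣ m ] typeCode a ≡ c × (φ ⟨ a ⟩) ∈ formulas 𝔮) ⌋

    GlobalCode-small : ∀ n → Sm (GlobalCode n)
    GlobalCode-small n = powerset-small (Σℕ-small λ m →
      ×-small (Formula-small L smallFun smallRel) (TypeCode-small m))

    -- A global type that does not Lascar-split over A is N-invariant.
    globalCode-⊆ : ∀ {n} (𝔮 𝔮′ : GlobalType {M = ℭ} n) → ¬ LascarSplits 𝕄 𝔮′ A →
      globalCode 𝔮 ≡ globalCode 𝔮′ → formulas 𝔮 ⊆ formulas 𝔮′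
    globalCode-⊆ 𝔮 𝔮′ ¬split e {φ ⟨ a ⟩} φ∈
      with complete 𝔮′ (φ ⟨ a ⟩) (VecAll.universal (λ _ → tt) a)
    ... | inj₁ φ∈′  = φ∈′
    ... | inj₂ ¬φ∈′ =
      let a′ , a′≡a , φa′∈ = ⌊⌋-≡⁻ (cong-app e (_ , φ , typeCode a)) (a , refl , φ∈)
          f , fixes , fa′≡a = conjugate {a = a′} {a} (typeCode-≡⁻ {a = a′} {a} a′≡a)
      in ⊥-elim (¬split (_ , φ , a′ , a , VecAll.universal (λ _ → tt) a′ , VecAll.universal (λ _ → tt) a ,
                         (f , fixing 𝑁 fixes , fa′≡a) , φa′∈ , ¬φ∈′))

  -- From Lascar-splitting to Strong bounded multiplicity.

  module _ {𝔄 : TypeClass 𝕄} (𝓡 : Rank 𝕄 𝔄) where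
    open TypeClass 𝔄 using (Member)
    open Rank 𝓡
    open OrdinalProperties em ext {ℓ}

    lascarSplittingRank⇒strongBoundedMultiplicity :
      LascarSplittingRank 𝕄 𝓡 → StrongBoundedMultiplicity 𝕄 𝓡
    -- Writing the bound as `suc k` gives the family in `fibreCover` a member at `zero`, whose
    -- extension serves as `𝔮₀`.
    lascarSplittingRank⇒strongBoundedMultiplicity splitting {n} {A} {p} p∈ ranked (suc k) 2≤k =
      κ , ×-small (GlobalCode-small n) (Lift-small ℕ-small) , inject
      where
      open OverModel (SkolemHull.model (TypeClass.small 𝔄 p∈))

      -- A code for the chosen invariant global extension, and a number for the type among the
      -- finitely many that share this code.
      κ : Set ℓ
      κ = GlobalCode n × Lift ℓ ℕ

      module _ (𝒬 : Collection 𝕄 𝓡 n)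
               (sameRank : ∀ {B q} → (B , q) ∈ 𝒬 → SameRankExtension 𝕄 𝓡 p∈ q)
               (inconsistent : _-Inconsistent_ 𝕄 𝓡 (suc k) 𝒬) where

        Element : Set _
        Element = Σ[ q ∈ _ ] q ∈ 𝒬

        typeOf : (x : Element) → S ℭ _ n
        typeOf ((_ , q) , _) = q

        InvariantExtension : Element → Set _
        InvariantExtension x = Σ[ 𝔮 ∈ GlobalType n ] (typeOf x ⊑ 𝔮) × ¬ LascarSplits 𝕄 𝔮 A

        -- If all global extensions of `q` Lascar-split over `A`, the rank would drop strictly,
        -- against R(q) = R(p).
        invariantExtension : (x : Element) → InvariantExtension x
        invariantExtension x@(_ , q∈𝒬) = let p⊑q , q∈ , Rq≈Rp = sameRank q∈𝒬 in
          ¬¬-elim {P = InvariantExtension x} λ ¬∃ → <∞⇒≱∞ (splitting p∈ q∈ p⊑q ranked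
            (λ 𝔮 q⊑𝔮 → ¬¬-elim λ ¬split → ¬∃ (𝔮 , (λ {φ} → q⊑𝔮 {φ}) , ¬split))) (≈∞⇒≥∞ Rq≈Rp)

        code : Element → GlobalCode n
        code x = globalCode (proj₁ (invariantExtension x))

        Fibre : GlobalCode n → Set _
        Fibre c = Σ[ x ∈ Element ] code x ≡ c

        infix 4 _~_

        _~_ : Element → Element → Set ℓ
        x ~ y = typeOf x ≋ typeOf y

        ~-sym : ∀ {x y} → x ~ y → y ~ x
        ~-sym (f , g) = g , f

        -- Types with one code are all included in one global type, so `suc k` distinct ones would
        -- be jointly consistent.
        fibreCover : ∀ c → ∃[ j ] Σ[ g ∈ (Fin j → Fibre c) ] ∀ x → ∃[ i ] proj₁ x ~ proj₁ (g i)
        fibreCover c with manyDistinct⊎finiteCover {X = Fibre c} (λ x y → proj₁ x ~ proj₁ y)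
                            (λ {x} {y} → ~-sym {proj₁ x} {proj₁ y}) (suc k)
        ... | inj₂ cover          = cover
        ... | inj₁ (q , distinct) = ⊥-elim (inconsistent (proj₁ ∘ proj₁ ∘ q) (proj₂ ∘ proj₁ ∘ q) distinct
            (λ Δ h → consistent 𝔮₀ Δ (All.map into𝔮₀ h)))
          where
          𝔮₀ : GlobalType n
          𝔮₀ = proj₁ (invariantExtension (proj₁ (q zero)))

          into𝔮₀ : ∀ {φ} → ∃[ i ] φ ∈ formulas (typeOf (proj₁ (q i))) → φ ∈ formulas 𝔮₀
          into𝔮₀ (i , φ∈) =
            let x , e = q i
                𝔮 , q⊑𝔮 , _ = invariantExtension x
            in globalCode-⊆ 𝔮 𝔮₀ (proj₂ (proj₂ (invariantExtension (proj₁ (q zero)))))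
                 (trans e (sym (proj₂ (q zero)))) (q⊑𝔮 φ∈)

        index : ∀ c → Fibre c → ℕ
        index c x = toℕ (proj₁ (proj₂ (proj₂ (fibreCover c)) x))

        index-separates : ∀ {c c′} ((x , e) : Fibre c) ((x′ , e′) : Fibre c′) → c ≡ c′ →
                          index c (x , e) ≡ index c′ (x′ , e′) → x ~ x′
        index-separates {c} x x′ refl eq with fibreCover c
        ... | j , g , cover with cover x | cover x′ | toℕ-injective eq
        ...   | i , (f₁ , f₂) | .i , (g₁ , g₂) | refl = (λ φ∈ → g₂ (f₁ φ∈)) , (λ φ∈ → f₂ (g₁ φ∈))

        inject : Injection (subset (typeSetoid ℭ n) 𝒬) (setoid κ)
        inject = separating⇒Injection (subset (typeSetoid ℭ n) 𝒬)
          (λ x → code x , lift (index (code x) (x , refl)))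
          (λ x y e → index-separates (x , refl) (y , refl) (cong proj₁ e) (cong (lower ∘ proj₂) e))

-- Restrictions and realizations of complete types.

module _ {ℓ : Level} {L : Language ℓ} {M : Structure L} where
  open Structure M using (Carrier)
  open S

  private
    variable
      n   : ℕ
      A B : Pred Carrier ℓ

  exclusive : (q : S M B n) {φ : ParamFormula M n} → φ ∈ formulas q → ¬ (¬ᵖ φ) ∈ formulas q
  exclusive q {φ} φ∈ ¬φ∈ with consistent q (φ ∷ (¬ᵖ φ) ∷ []) (φ∈ ∷ ¬φ∈ ∷ [])
  ... | _ , xφ ∷ ¬xφ ∷ [] = Poly.⊥-elim (¬xφ xφ)

  ⊑-reflects : (q : S M A n) (q′ : S M B n) → q ⊑ q′ → ∀ {φ} → φ Over A → φ ∈ formulas q′ → φ ∈ formulas q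
  ⊑-reflects q q′ q⊑q′ {φ} o φ∈ with complete q φ o
  ... | inj₁ φ∈q  = φ∈q
  ... | inj₂ ¬φ∈q = ⊥-elim (exclusive q′ φ∈ (q⊑q′ ¬φ∈q))

  realizes⇒∈ : (q : S M B n) {x : Vec Carrier n} → (∀ {φ} → φ ∈ formulas q → x ⊩ φ) →
               ∀ {φ} → φ Over B → x ⊩ φ → φ ∈ formulas q
  realizes⇒∈ q x⊩q {φ} o xφ with complete q φ o
  ... | inj₁ φ∈  = φ∈
  ... | inj₂ ¬φ∈ = Poly.⊥-elim (x⊩q ¬φ∈ xφ)

  restrict : S M B n → A ⊆ B → S M A n
  restrict {A = A} q A⊆B = record
    { formulas   = λ φ → φ ∈ formulas q × φ Over A
    ; over       = proj₂
    ; consistent = λ Δ h → consistent q Δ (All.map proj₁ h)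
    ; complete   = λ φ o → Sum.map (_, o) (_, o) (complete q φ (VecAll.map A⊆B o))
    }

  Entries : ∀ {K : Set ℓ} {m} → (K → Vec Carrier m) → Pred Carrier ℓ
  Entries g x = ∃[ k ] ∃[ i ] lookup (g k) i ≡ x

  ∈-Entries : ∀ {K : Set ℓ} {m} (g : K → Vec Carrier m) k → g k ∈ᵗ Entries g
  ∈-Entries g k = VecAllₚ.lookup⁻ (λ i → k , i , refl)

  -- An assignment of [ α , x ] to the variables of φ, as a realization by
  -- x of a formula with parameters from α; the parameter slots that stand
  -- for entries of x are filled with the junk value α j₀.
  module Slots {X : Set ℓ} (j₀ : X) (α : X → Carrier) {m : ℕ} where

    slots : ∀ {j} → Vec (X ⊎ Fin m) j → Vec X j
    slots = Vec.map [ id , const j₀ ]′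

    place : ∀ {j} → Vec (X ⊎ Fin m) j → Fin j → Fin (m + j)
    place {j} i t = [ const (m ↑ʳ t) , _↑ˡ j ]′ (lookup i t)

    ⊩-slots : ∀ {j} (φ : Formula L j) (i : Vec (X ⊎ Fin m) j) (x : Vec Carrier m) →
      x ⊩ (rename (place i) φ ⟨ Vec.map α (slots i) ⟩) ⇔ M ⊨ φ [ Vec.map [ α , lookup x ]′ i ]
    ⊩-slots {j} φ i x = ⊨-rename M (place i) _ _ at φ
      where
      at : ∀ t → lookup (x ++ Vec.map α (slots i)) (place i t) ≡ lookup (Vec.map [ α , lookup x ]′ i) t
      at t rewrite lookup-map t [ α , lookup x ]′ i with lookup i t in eq
      ... | inj₂ s = lookup-++ˡ x _ s
      ... | inj₁ y = trans (lookup-++ʳ x _ t) (trans (lookup-map t α (slots i))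
                       (cong α (trans (lookup-map t [ id , const j₀ ]′ i) (cong [ id , const j₀ ]′ eq))))

-- From Bounded multiplicity and Extension to Lascar-splitting.

module LascarInvariance (em : ∀ {a} → ExcludedMiddle a) (ext : ∀ {a b} → Extensionality a b)
  {ℓ : Level} {L : Language ℓ} {T : Theory L} (𝕄 : MonsterModel T) where
  open Classical em ext
  open MonsterModel 𝕄
  open Smallness em ext κ̄ inaccessible
  open MonsterProperties em ext 𝕄
  open TypeConstruction em ext {M = ℭ}
  open OrdinalProperties em ext {ℓ}
  open S
  open Aut using (to; from)

  -- The converse implication is the given one for the negated formula.
  sameType : {I : Set ℓ} {a b : I → ∣ℭ∣} →
    (∀ {n} (φ : Formula L n) i → ℭ ⊨ φ [ Vec.map a i ] → ℭ ⊨ φ [ Vec.map b i ]) → SameType a b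
  sameType h φ i = mk⇔ (h φ i) λ q → ¬¬-elim λ ¬p →
    ⊥-elim (Poly.⊥-elim (h (¬′_ L φ) i (λ p → ⊥-elim (¬p p)) q))

  Entries-small : ∀ {K : Set ℓ} {m} → Sm K → (g : K → Vec ∣ℭ∣ m) → Small (Entries {M = ℭ} g)
  Entries-small {K} {m} K-small g = covered-small (K × Lift ℓ (Fin m)) (λ (k , lift i) → lookup (g k) i)
    (×-small K-small (Lift-small Fin-small)) (λ (k , i , e) → (k , lift i) , e)

  map-fixed : ∀ {A : Pred ∣ℭ∣ ℓ} {f : Aut ℭ} → FixesPointwise 𝕄 A f →
              ∀ {m} {a : Vec ∣ℭ∣ m} → a ∈ᵗ A → Vec.map (to f) a ≡ a
  map-fixed fixes []       = refl
  map-fixed {f = f} fixes (x∈ ∷ h) = cong₂ _∷_ (fixes x∈) (map-fixed {f = f} fixes h)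

  module _ {𝔄 : TypeClass 𝕄} (𝓡 : Rank 𝕄 𝔄)
           (bounded : BoundedMultiplicity 𝕄 𝓡) (extends : Extension 𝕄 𝓡) where
    open TypeClass 𝔄 hiding (small)
    open Rank 𝓡

    module _ {n : ℕ} {A : Pred ∣ℭ∣ ℓ} {p : S ℭ A n} (p∈ : Member p) (ranked : Ranked p∈) where

      SameRank : ∀ {B} → S ℭ B n → Set _
      SameRank q = SameRankExtension 𝕄 𝓡 p∈ q

      sameRank-intro : ∀ {B} {q : S ℭ B n} → p ⊑ q → (q∈ : Member q) → R p∈ ≤∞ R q∈ → SameRank q
      sameRank-intro p⊑q q∈ Rp≤Rq = p⊑q , q∈ , ≤∞-antisym (heredity p∈ q∈ p⊑q) Rp≤Rq

      grow : ∀ {B C} {q : S ℭ B n} → SameRank q → Small C →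
             Σ[ q⁺ ∈ S ℭ (B ∪ C) n ] (q ⊑ q⁺) × SameRank q⁺
      grow {B} {C} (p⊑q , q∈ , Rq≈Rp) C-small =
        let q⁺ , q⊑q⁺ , q⁺∈ , Rq⁺≈Rq = extends q∈ (≤∞-<∞-trans (≈∞⇒≤∞ Rq≈Rp) ranked) (B ∪ C)
                                         (∪-small (TypeClass.small 𝔄 q∈) C-small) inj₁
        in q⁺ , q⊑q⁺ , sameRank-intro (λ φ∈ → q⊑q⁺ (p⊑q φ∈)) q⁺∈
                         (≤∞-trans (≈∞⇒≥∞ Rq≈Rp) (≈∞⇒≥∞ Rq⁺≈Rq))

      -- The restriction lies between `p` and `q`, so Heredity squeezes its rank.
      restrict-sameRank : ∀ {B C} {q : S ℭ B n} → SameRank q → Small C → A ⊆ C → (C⊆B : C ⊆ B) →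
                          SameRank (restrict q C⊆B)
      restrict-sameRank {q = q} (p⊑q , q∈ , Rq≈Rp) C-small A⊆C C⊆B =
        sameRank-intro p⊑r r∈ (≤∞-trans (≈∞⇒≥∞ Rq≈Rp) (heredity r∈ q∈ proj₁))
        where
        p⊑r : p ⊑ restrict q C⊆B
        p⊑r φ∈ = p⊑q φ∈ , VecAll.map A⊆C (over p φ∈)

        r∈ : Member (restrict q C⊆B)
        r∈ = extension p∈ C-small p⊑r

      -- The inverse is used because φ(x,c) is in `q ^ (f ⁻¹ᴬ)` exactly when φ(x,f(c)) is in `q`.
      -- Formulas of `p` are unmoved, as their parameters lie in `A`.
      conjugate-sameRank : ∀ {B} {q : S ℭ B n} (f : Aut ℭ) → FixesPointwise 𝕄 A f →
                           SameRank q → SameRank (q ^ (f ⁻¹ᴬ))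
      conjugate-sameRank {q = q} f fixes (p⊑q , q∈ , Rq≈Rp) = sameRank-intro
        (λ {φ} φ∈ → p⊑q (subst (λ a → (ParamFormula.formula φ ⟨ a ⟩) ∈ formulas p)
                               (sym (map-fixed {f = f} fixes (over p φ∈))) φ∈))
        (conjugation q∈ (f ⁻¹ᴬ))
        (≤∞-trans (≈∞⇒≥∞ Rq≈Rp) (≈∞⇒≤∞ (isomorphism q∈ (f ⁻¹ᴬ))))

      module _ {m : ℕ} (φ : Formula L (n + m)) where

        infix 4 _⇝_ _~_

        _⇝_ _~_ : Vec ∣ℭ∣ m → Vec ∣ℭ∣ m → Set _
        c ⇝ d = ∀ {B} (q : S ℭ B n) → SameRank q → c ∈ᵗ B → d ∈ᵗ B →
                (φ ⟨ c ⟩) ∈ formulas q → (φ ⟨ d ⟩) ∈ formulas q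
        c ~ d = (c ⇝ d) × (d ⇝ c)

        -- The middle tuple `d` may lie outside the domain of `q`. Extension adds it without
        -- changing the rank, and the conclusion is read back in `q`.
        ⇝-trans : ∀ {c d e} → c ⇝ d → d ⇝ e → c ⇝ e
        ⇝-trans {c} {d} {e} c⇝d d⇝e q q∈ c∈ e∈ φc∈ =
          let q⁺ , q⊑q⁺ , q⁺∈ = grow q∈ (Entries-small {Lift ℓ (Fin 1)} (Lift-small Fin-small) (λ _ → d))
              d∈ = VecAll.map inj₂ (∈-Entries {M = ℭ} (λ _ → d) (lift zero))
          in ⊑-reflects q q⁺ q⊑q⁺ e∈
               (d⇝e q⁺ q⁺∈ d∈ (VecAll.map inj₁ e∈)
                 (c⇝d q⁺ q⁺∈ (VecAll.map inj₁ c∈) d∈ (q⊑q⁺ φc∈)))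

        ~-refl : ∀ {c} → c ~ c
        ~-refl = (λ _ _ _ _ φ∈ → φ∈) , (λ _ _ _ _ φ∈ → φ∈)

        ~-sym : ∀ {c d} → c ~ d → d ~ c
        ~-sym (f , g) = g , f

        ~-trans : ∀ {c d e} → c ~ d → d ~ e → c ~ e
        ~-trans {c} {d} {e} (f , g) (f′ , g′) = ⇝-trans {c} {d} {e} f f′ , ⇝-trans {e} {d} {c} g′ g

        ⇝-invariant : ∀ (f : Aut ℭ) → FixesPointwise 𝕄 A f → ∀ {c d} → c ⇝ d →
                      Vec.map (to f) c ⇝ Vec.map (to f) d
        ⇝-invariant f fixes c⇝d q q∈ c∈ d∈ =
          c⇝d (q ^ (f ⁻¹ᴬ)) (conjugate-sameRank f fixes q∈) (VecAllₚ.map⁻ c∈) (VecAllₚ.map⁻ d∈)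

        ~-invariant : ∀ (f : Aut ℭ) → FixesPointwise 𝕄 A f → ∀ {c d} → c ~ d →
                      Vec.map (to f) c ~ Vec.map (to f) d
        ~-invariant f fixes {c} {d} (h , h′) =
          ⇝-invariant f fixes {c} {d} h , ⇝-invariant f fixes {d} {c} h′

        κ : Set ℓ
        κ = proj₁ (bounded p∈ ranked)

        -- The double power set of `κ` is still small, but has no injection into the power set of
        -- `κ`.
        K : Set ℓ
        K = (κ → Bool) → Bool

        K-small : Sm K
        K-small = powerset-small (powerset-small (proj₁ (proj₂ (bounded p∈ ranked))))

        -- Over A and the entries of g there are at most κ same-rank
        -- extensions of p, and they distinguish the tuples g k.
        ~-bounded : (g : K → Vec ∣ℭ∣ m) → ¬ (∀ k k′ → g k ~ g k′ → k ≡ k′)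
        ~-bounded g separates = cantor trace λ k k′ e →
          separates k k′ (trace-≡⇒⇝ k k′ e , trace-≡⇒⇝ k′ k (sym e))
          where
          B : Pred ∣ℭ∣ ℓ
          B = A ∪ Entries {M = ℭ} g

          B-small : Small B
          B-small = ∪-small (TypeClass.small 𝔄 p∈) (Entries-small K-small g)

          module ι = Injection (proj₂ (proj₂ (bounded p∈ ranked)) B B-small inj₁)

          trace : K → κ → Bool
          trace k j = ⌊ (Σ[ q ∈ Σ (S ℭ B n) SameRank ] ι.to q ≡ j × (φ ⟨ g k ⟩) ∈ formulas (proj₁ q)) ⌋

          over-B : ∀ k → g k ∈ᵗ B
          over-B k = VecAll.map inj₂ (∈-Entries {M = ℭ} g k)

          -- Bounded multiplicity counts types over exactly `B`, so `q` is enlarged to cover `B` and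
          -- then restricted to it. Equal traces give a type with the same label, hence the same
          -- formulas.
          trace-≡⇒⇝ : ∀ k k′ → trace k ≡ trace k′ → g k ⇝ g k′
          trace-≡⇒⇝ k k′ e q q∈ k∈ k′∈ φ∈ =
            let q⁺ , q⊑q⁺ , q⁺∈ = grow q∈ B-small
                q₁ = restrict q⁺ inj₂
                q₁∈ = restrict-sameRank q⁺∈ B-small inj₁ inj₂
                q₂ , ιq₂≡ιq₁ , φ∈q₂ = ⌊⌋-≡⁻ (cong-app e (ι.to (q₁ , q₁∈)))
                                        ((q₁ , q₁∈) , refl , q⊑q⁺ φ∈ , over-B k)
                φ∈q₁ = proj₁ (ι.injective ιq₂≡ιq₁) φ∈q₂
            in ⊑-reflects q q⁺ q⊑q⁺ k′∈ (proj₁ φ∈q₁)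

        module _ (𝑁 : SmallModelContaining 𝕄 A) where
          open OverModel 𝑁 hiding (conjugate)

          ≡ᴺ-trans : ∀ {a b c : Vec ∣ℭ∣ m} → a ≡ᴺ b → a ≡ᴺ c → b ≡ᴺ c
          ≡ᴺ-trans a≡b a≡c ψ i = mk⇔
            (λ h → Equivalence.to (a≡c ψ i) (Equivalence.from (a≡b ψ i) h))
            (λ h → Equivalence.to (a≡b ψ i) (Equivalence.from (a≡c ψ i) h))

          n₀ : ∣N∣
          n₀ = Structure.nonempty N

          fixes-A : ∀ {f} → FixesPointwise 𝕄 universe f → FixesPointwise 𝕄 A f
          fixes-A fixes x∈A = fixes (contains x∈A)

          module _ (a : Vec ∣ℭ∣ m) (g : K → Vec ∣ℭ∣ m) (g≡a : ∀ k → a ≡ᴺ g k) where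

            N∪g : Pred ∣ℭ∣ ℓ
            N∪g = universe ∪ Entries {M = ℭ} g

            N∪g-small : Small N∪g
            N∪g-small = ∪-small (covered-small ∣N∣ embed small id) (Entries-small K-small g)

            assign-over : ∀ k {j} (i : Vec (∣N∣ ⊎ Fin m) j) → Vec.map (assign (g k)) i ∈ᵗ N∪g
            assign-over k []           = []
            assign-over k (inj₁ y ∷ i) = inj₁ (y , refl) ∷ assign-over k i
            assign-over k (inj₂ t ∷ i) = inj₂ (k , t , refl) ∷ assign-over k i

            -- Data for an instance of non-splitting over `N`: the same formula and the same
            -- parameters from `N`, with the entries of `g k` exchanged for those of `g k′`.
            Constraint : Set ℓ
            Constraint = Σ[ j ∈ ℕ ] Formula L (m + j) × Vec (∣N∣ ⊎ Fin m) j × K × K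

            Satisfies : Vec ∣ℭ∣ m → Constraint → Set ℓ
            Satisfies x (_ , ψ , i , k , k′) =
              _⊩_ {M = ℭ} x (ψ ⟨ Vec.map (assign (g k)) i ⟩) → _⊩_ {M = ℭ} x (ψ ⟨ Vec.map (assign (g k′)) i ⟩)

            submodel-satisfies : ∀ (y : Vec ∣N∣ m) z → Satisfies (Vec.map embed y) z
            submodel-satisfies y (_ , ψ , i , k , k′) h =
              subst (λ v → ℭ ⊨ ψ [ v ]) (split k′)
                (Equivalence.to (≡ᴺ-trans {a} {g k} {g k′} (g≡a k) (g≡a k′) ψ (Vec.map inj₁ y ++ i))
                  (subst (λ v → ℭ ⊨ ψ [ v ]) (sym (split k)) h))
              where
              split : ∀ k → Vec.map (assign (g k)) (Vec.map inj₁ y ++ i) ≡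
                            Vec.map embed y ++ Vec.map (assign (g k)) i
              split k = trans (map-++ (assign (g k)) (Vec.map inj₁ y) i)
                              (cong (_++ Vec.map (assign (g k)) i) (sym (map-∘ (assign (g k)) inj₁ y)))

            TypeOverN : Pred (ParamFormula ℭ m) ℓ
            TypeOverN ψ = ψ Over universe × a ⊩ ψ

            -- Parameters with the same type over N cannot be told apart by
            -- tuples from N, so the non-splitting constraints are finitely
            -- satisfiable in N along with the type of a.
            nonsplittingType = lindenbaum N∪g TypeOverN
              (λ (o , _) → VecAll.map inj₁ o) Satisfies
              (λ Δ Θ h → let y , real = realizedInSubmodel N≼ℭ Δ (All.map proj₁ h) a (All.map proj₂ h)
                         in Vec.map embed y , real , All.universal (submodel-satisfies y) Θ)

            r : S ℭ N∪g m
            r = proj₁ nonsplittingType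

            a* : Vec ∣ℭ∣ m
            a* = proj₁ (saturated N∪g-small r)

            a*⊩r : ∀ {ψ} → ψ ∈ formulas r → a* ⊩ ψ
            a*⊩r = proj₂ (saturated N∪g-small r)

            a≡a* : a ≡ᴺ a*
            a≡a* = sameType λ ψ i h → Equivalence.to (⊩-slots ψ i a*)
              (a*⊩r (proj₁ (proj₂ nonsplittingType) {rename (place i) ψ ⟨ _ ⟩}
                (embed-over (slots i) , Equivalence.from (⊩-slots ψ i a) h)))
              where
              open Slots {M = ℭ} n₀ embed {m}

              embed-over : ∀ {j} (v : Vec ∣N∣ j) → Vec.map embed v ∈ᵗ universe
              embed-over []      = []
              embed-over (y ∷ v) = (y , refl) ∷ embed-over v

            -- A counterexample would put a formula at `g k` and its negation at `g k′` into `r`,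
            -- although `r` is finitely satisfiable together with the constraint for this pair.
            a*-nonsplitting : ∀ k k′ → SameType [ assign (g k) , lookup a* ]′ [ assign (g k′) , lookup a* ]′
            a*-nonsplitting k k′ = sameType λ {j} ψ i h → ¬¬-elim λ ¬h →
              let χ = rename (Sₖ.place i) ψ
                  χ∈  = realizes⇒∈ r a*⊩r {χ ⟨ _ ⟩} (assign-over k (Sₖ.slots i))
                          (Equivalence.from (Sₖ.⊩-slots ψ i a*) h)
                  ¬χ∈ = realizes⇒∈ r a*⊩r {¬ᵖ (χ ⟨ _ ⟩)} (assign-over k′ (Sₖ.slots i))
                          (λ h′ → ⊥-elim (¬h (Equivalence.to (Sₖ′.⊩-slots ψ i a*) h′)))
                  x , real , sat = proj₂ (proj₂ nonsplittingType) (_ ∷ _ ∷ [])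
                                     ((_ , χ , Sₖ.slots i , k , k′) ∷ []) (χ∈ ∷ ¬χ∈ ∷ [])
              in Poly.⊥-elim (All.head (All.tail real) (All.head sat (All.head real)))
              where
              module Sₖ  = Slots {M = ℭ} (inj₁ n₀) (assign (g k)) {m}
              module Sₖ′ = Slots {M = ℭ} (inj₁ n₀) (assign (g k′)) {m}

            -- By strong homogeneity some automorphism fixes `N` and `a*` and moves `g k` to `g k′`;
            -- it preserves `~`.
            a*~-constant : ∀ k k′ → a* ~ g k → a* ~ g k′
            a*~-constant k k′ a*~gk =
              let f , h = homogeneous (⊎Fin-small (⊎Fin-small small)) [ assign (g k) , lookup a* ]′
                            [ assign (g k′) , lookup a* ]′ (a*-nonsplitting k k′)
              in subst₂ _~_
                   (lookup-ext (λ i → trans (lookup-map i (to f) a*) (h (inj₂ i))))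
                   (lookup-ext (λ i → trans (lookup-map i (to f) (g k)) (h (inj₁ (inj₂ i)))))
                   (~-invariant f (fixes-A {f} λ { (y , refl) → h (inj₁ (inj₁ y)) }) {a*} {g k} a*~gk)

          -- By `~-bounded`, `K` does not inject into the classes, so `g` can be chosen to represent
          -- every class that meets the type of `a` over `N`.
          ≡ᴺ⇒~ : ∀ {a b} → a ≡ᴺ b → a ~ b
          ≡ᴺ⇒~ {a} {b} a≡b with Comparison.injects⊎covers {V = Σ (Vec ∣ℭ∣ m) (a ≡ᴺ_)} {K = K}
              (λ c d → proj₁ c ~ proj₁ d) (a , λ ψ i → mk⇔ id id)
              (λ {c} → ~-refl {proj₁ c}) (λ {c} {d} → ~-sym {proj₁ c} {proj₁ d})
              (λ {c} {d} {e} → ~-trans {proj₁ c} {proj₁ d} {proj₁ e})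
          ... | inj₁ (g , separates) = ⊥-elim (~-bounded (proj₁ ∘ g) separates)
          ... | inj₂ (g , covers) =
            let g₁ = proj₁ ∘ g
                g≡a = proj₂ ∘ g
                c = a* a g₁ g≡a
                -- `c` realizes the type of `a` over `N`, so it has a representative too and is then
                -- equivalent to all of them.
                k₀ , c~k₀ = covers (c , a≡a* a g₁ g≡a)
                k₁ , a~k₁ = covers (a , λ ψ i → mk⇔ id id)
                k₂ , b~k₂ = covers (b , a≡b)
                c~ = λ k → a*~-constant a g₁ g≡a k₀ k c~k₀
            in ~-trans {a} {c} {b}
                 (~-trans {a} {g₁ k₁} {c} a~k₁ (~-sym {c} {g₁ k₁} (c~ k₁)))
                 (~-trans {c} {g₁ k₂} {b} (c~ k₂) (~-sym {b} {g₁ k₂} b~k₂))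

          fixing⇒~ : ∀ (f : Aut ℭ) → FixesPointwise 𝕄 universe f → ∀ a → a ~ Vec.map (to f) a
          fixing⇒~ f fixes a = ≡ᴺ⇒~ λ ψ i →
            subst (λ v → ℭ ⊨ ψ [ Vec.map (assign a) i ] ⇔ ℭ ⊨ ψ [ v ])
                  (trans (sym (map-∘ (to f) (assign a) i)) (map-cong moved i))
                  (⊨-aut f ψ (Vec.map (assign a) i))
            where
            moved : ∀ y → to f (assign a y) ≡ assign (Vec.map (to f) a) y
            moved (inj₁ y) = fixes (y , refl)
            moved (inj₂ t) = sym (lookup-map t (to f) a)

        Autf⇒~ : ∀ {f} → Autf 𝕄 A f → ∀ a → a ~ Vec.map (to f) a
        Autf⇒~ (fixing {f} 𝑁 fixes) a = fixing⇒~ 𝑁 f fixes a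
        Autf⇒~ unit a = subst (a ~_) (sym (map-id a)) (~-refl {a})
        Autf⇒~ (compose {f} {g} f∈ g∈) a = subst (a ~_) (sym (map-∘ (to f) (to g) a))
          (~-trans {a} {Vec.map (to g) a} (Autf⇒~ g∈ a) (Autf⇒~ f∈ (Vec.map (to g) a)))
        Autf⇒~ (inverse {f} f∈) a = ~-sym {Vec.map (from f) a} {a}
          (subst (Vec.map (from f) a ~_) (Aut.map-to-from f a) (Autf⇒~ f∈ (Vec.map (from f) a)))
        Autf⇒~ (respect f≗g f∈) a = subst (a ~_) (map-cong f≗g a) (Autf⇒~ f∈ a)

      -- Finitely many constraints involve finitely many parameters. A same-rank extension of `q`
      -- over these is realized by saturation, and the realization respects the constraints since
      -- Lascar equivalent tuples are `~`-related.
      nonsplittingExtension : ∀ {B} (q : S ℭ B n) → SameRank q →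
                              Σ[ 𝔮 ∈ GlobalType n ] (q ⊑ 𝔮) × ¬ LascarSplits 𝕄 𝔮 A
      nonsplittingExtension {B} q q∈ =
        let 𝔮 , q⊑𝔮 , satisfiable = lindenbaum (λ _ → _) (formulas q) (λ _ → VecAll.universal (λ _ → tt) _)
                                      Respects (λ Δ Θ h → realizer Δ Θ h)
        in 𝔮 , q⊑𝔮 , λ (_ , φ , a , b , _ , _ , a≡b , φa∈ , ¬φb∈) →
             let x , real , sat = satisfiable (_ ∷ _ ∷ []) ((_ , φ , a , b , ⌊⌋-intro a≡b) ∷ [])
                                    (φa∈ ∷ ¬φb∈ ∷ [])
             in Poly.⊥-elim (All.head (All.tail real) (All.head sat (All.head real)))
        where
        -- The truth value keeps this in `Set ℓ`, as `lindenbaum` requires; `LascarEquiv` lives one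
        -- universe higher.
        LascarPair : Set ℓ
        LascarPair = Σ[ m ∈ ℕ ] Σ[ φ ∈ Formula L (n + m) ] Σ[ a ∈ Vec ∣ℭ∣ m ] Σ[ b ∈ Vec ∣ℭ∣ m ]
                     ⌊ LascarEquiv 𝕄 A a b ⌋ ≡ true

        Respects : Vec ∣ℭ∣ n → LascarPair → Set ℓ
        Respects x (_ , φ , a , b , _) = _⊩_ {M = ℭ} x (φ ⟨ a ⟩) → _⊩_ {M = ℭ} x (φ ⟨ b ⟩)

        Params : List LascarPair → Pred ∣ℭ∣ ℓ
        Params []                        = λ _ → Poly.⊥
        Params ((m , φ , a , b , _) ∷ Θ) =
          (Entries {M = ℭ} {Lift ℓ (Fin 1)} (λ _ → a) ∪ Entries {M = ℭ} {Lift ℓ (Fin 1)} (λ _ → b)) ∪ Params Θ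

        Params-small : ∀ Θ → Small (Params Θ)
        Params-small []      = covered-small (Lift ℓ (Fin 0)) (λ { (lift ()) }) (Lift-small Fin-small) (λ ())
        Params-small ((_ , _ , a , b , _) ∷ Θ) = ∪-small
          (∪-small (Entries-small (Lift-small Fin-small) (λ _ → a)) (Entries-small (Lift-small Fin-small) (λ _ → b)))
          (Params-small Θ)

        sat : ∀ {C} (q⁺ : S ℭ C n) → SameRank q⁺ → ∀ {x} → (∀ {φ} → φ ∈ formulas q⁺ → x ⊩ φ) →
              ∀ Θ → Params Θ ⊆ C → All (Respects x) Θ
        sat q⁺ q⁺∈ x⊩ []      Θ⊆ = []
        sat q⁺ q⁺∈ x⊩ ((m , φ , a , b , a≡b) ∷ Θ) Θ⊆ =
          (λ h → x⊩ (a⇝b q⁺ q⁺∈ a∈ b∈ (realizes⇒∈ q⁺ x⊩ {φ ⟨ a ⟩} a∈ h)))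
          ∷ sat q⁺ q⁺∈ x⊩ Θ (λ x∈ → Θ⊆ (inj₂ x∈))
          where
          a∈ = VecAll.map (λ x∈ → Θ⊆ (inj₁ (inj₁ x∈))) (∈-Entries {M = ℭ} (λ _ → a) (lift zero))
          b∈ = VecAll.map (λ x∈ → Θ⊆ (inj₁ (inj₂ x∈))) (∈-Entries {M = ℭ} (λ _ → b) (lift zero))

          a⇝b : _⇝_ φ a b
          a⇝b with ⌊⌋-elim a≡b
          ... | f , f∈ , refl = proj₁ (Autf⇒~ φ f∈ a)

        realizer : ∀ Δ Θ → All (_∈ formulas q) Δ → ∃[ x ] All (x ⊩_) Δ × All (Respects x) Θ
        realizer Δ Θ h =
          let q⁺ , q⊑q⁺ , q⁺∈ = grow q∈ (Params-small Θ)
              x , x⊩ = saturated (TypeClass.small 𝔄 (proj₁ (proj₂ q⁺∈))) q⁺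
          in x , All.map (λ φ∈ → x⊩ (q⊑q⁺ φ∈)) h , sat q⁺ q⁺∈ x⊩ Θ inj₂

    lascarSplittingRank : LascarSplittingRank 𝕄 𝓡
    lascarSplittingRank {q = q} p∈ q∈ p⊑q ranked splits =
      ≤∞∧≱∞⇒<∞ (heredity p∈ q∈ p⊑q) λ Rp≤Rq →
        let 𝔮 , q⊑𝔮 , ¬split = nonsplittingExtension p∈ ranked q (sameRank-intro p∈ ranked p⊑q q∈ Rp≤Rq)
        in ¬split (splits 𝔮 q⊑𝔮)

proposition2p22 : ∀ {ℓ} → (∀ {a} → ExcludedMiddle a) → (∀ {a b} → Extensionality a b) →
    (L : Language ℓ) (T : Theory L) → Complete T → (𝕄 : MonsterModel T) →
    (𝔄 : TypeClass 𝕄) (R : Rank 𝕄 𝔄) →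
    (LascarSplittingRank 𝕄 R → StrongBoundedMultiplicity 𝕄 R) ×
    (BoundedMultiplicity 𝕄 R × Extension 𝕄 R → LascarSplittingRank 𝕄 R)
proposition2p22 em ext L T _ 𝕄 𝔄 R =
  MonsterProperties.lascarSplittingRank⇒strongBoundedMultiplicity em ext 𝕄 R ,
  λ (bounded , extends) → LascarInvariance.lascarSplittingRank em ext 𝕄 R bounded extends
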